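{- Let $r\ge 0$ be an integer and let $S$ be a connected graph with at least three vertices and $S\neq P_3$. Then the statement "every connected claw-$o_r$-heavy $S$-free graph is traceable" holds if and only if $S\in\{C_3,Z_1,P_4\}$.
   Context: All graphs are finite and simple; $d(v)$ is the degree of $v$ in $G$. $P_i$ is the path on $i$ vertices, $C_3$ the triangle, $Z_1$ the graph obtained from a triangle by attaching one pendant vertex to one of its vertices, and a claw is $K_{1,3}$. For an integer $r$, a graph $G$ on $n$ vertices is claw-$o_r$-heavy if every induced subgraph of $G$ isomorphic to $K_{1,3}$ contains two nonadjacent vertices whose degree sum in $G$ is at least $n+r$. $G$ is $S$-free if it has no induced subgraph isomorphic to $S$. Traceable means having a path through all vertices. -}

module Defs where

open import Data.Nat using (ℕ; zero; suc; _+_; _≤_)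
open import Data.Fin using (Fin; zero; suc; toℕ; _≟_)
open import Data.Bool using (Bool; true; false; if_then_else_; _∨_)
open import Data.Bool.Properties using (∨-comm)
open import Data.Product using (Σ; ∃; _×_; _,_)
open import Data.Sum using (_⊎_)
open import Relation.Nullary using (¬_; yes; no)
open import Relation.Binary.PropositionalEquality using (_≡_; _≢_; refl; sym)
open import Function.Definitions using (Injective)

record Graph : Set where
  field
    n      : ℕ
    adj    : Fin n → Fin n → Bool
    adj-sym   : ∀ i j → adj i j ≡ adj j i
    adj-irrefl : ∀ i → adj i i ≡ false
open Graph public

mkAdj : ∀ {k} → (Fin k → Fin k → Bool) → Fin k → Fin k → Bool
mkAdj e i j with i ≟ j
... | yes _ = false
... | no  _ = e i j ∨ e j i

mkAdj-sym : ∀ {k} (e : Fin k → Fin k → Bool) i j → mkAdj e i j ≡ mkAdj e j i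
mkAdj-sym e i j with i ≟ j | j ≟ i
... | yes _ | yes _ = refl
... | yes p | no ¬q = Relation.Nullary.contradiction (sym p) ¬q
... | no ¬p | yes q = Relation.Nullary.contradiction (sym q) ¬p
... | no _  | no _  = ∨-comm (e i j) (e j i)

mkAdj-irrefl : ∀ {k} (e : Fin k → Fin k → Bool) i → mkAdj e i i ≡ false
mkAdj-irrefl e i with i ≟ i
... | yes _ = refl
... | no ¬p = Relation.Nullary.contradiction refl ¬p

mkGraph : (k : ℕ) → (Fin k → Fin k → Bool) → Graph
mkGraph k e = record
  { n = k ; adj = mkAdj e ; adj-sym = mkAdj-sym e ; adj-irrefl = mkAdj-irrefl e }

count : ∀ k → (Fin k → Bool) → ℕ
count zero    f = 0
count (suc k) f = (if f zero then 1 else 0) + count k (λ u → f (suc u))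

deg : (G : Graph) → Fin (n G) → ℕ
deg G v = count (n G) (adj G v)

InducedCopy : (H G : Graph) → (Fin (n H) → Fin (n G)) → Set
InducedCopy H G f = Injective _≡_ _≡_ f × (∀ i j → adj G (f i) (f j) ≡ adj H i j)

Free : (S G : Graph) → Set
Free S G = ∀ f → ¬ InducedCopy S G f

Iso : (G H : Graph) → Set
Iso G H = Σ (Fin (n G) → Fin (n H)) λ f → Σ (Fin (n H) → Fin (n G)) λ g →
            (∀ x → g (f x) ≡ x) × (∀ y → f (g y) ≡ y) ×
            (∀ i j → adj H (f i) (f j) ≡ adj G i j)

data Reach (G : Graph) : Fin (n G) → Fin (n G) → Set where
  here : ∀ {u} → Reach G u u
  step : ∀ {u v w} → adj G u v ≡ true → Reach G v w → Reach G u w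

Connected : Graph → Set
Connected G = ∀ u v → Reach G u v

-- Traceable: an ordering p of all vertices (a bijection, here an injection
-- Fin n → Fin n) with consecutive vertices adjacent.
Traceable : Graph → Set
Traceable G = Σ (Fin (n G) → Fin (n G)) λ p → Injective _≡_ _≡_ p ×
  (∀ i j → toℕ j ≡ suc (toℕ i) → adj G (p i) (p j) ≡ true)

P3 : Graph
P3 = mkGraph 3 e
  where
  e : Fin 3 → Fin 3 → Bool
  e zero (suc zero) = true
  e (suc zero) (suc (suc zero)) = true
  e _ _ = false

P4 : Graph
P4 = mkGraph 4 e
  where
  e : Fin 4 → Fin 4 → Bool
  e zero (suc zero) = true
  e (suc zero) (suc (suc zero)) = true
  e (suc (suc zero)) (suc (suc (suc zero))) = true
  e _ _ = false

C3 : Graph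
C3 = mkGraph 3 e
  where
  e : Fin 3 → Fin 3 → Bool
  e _ _ = true

Z1 : Graph
Z1 = mkGraph 4 e
  where
  e : Fin 4 → Fin 4 → Bool
  e zero (suc zero) = true
  e zero (suc (suc zero)) = true
  e (suc zero) (suc (suc zero)) = true
  e zero (suc (suc (suc zero))) = true
  e _ _ = false

Claw : Graph
Claw = mkGraph 4 e
  where
  e : Fin 4 → Fin 4 → Bool
  e zero (suc _) = true
  e _ _ = false

ClawHeavy : ℕ → Graph → Set
ClawHeavy r G = ∀ f → InducedCopy Claw G f →
  Σ (Fin 4) λ i → Σ (Fin 4) λ j →
    i ≢ j × adj G (f i) (f j) ≡ false × n G + r ≤ deg G (f i) + deg G (f j)

ForbiddenTraceable : ℕ → Graph → Set
ForbiddenTraceable r S = (G : Graph) → Connected G → ClawHeavy r G → Free S G → Traceable G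

{-# OPTIONS --safe #-}
module Submission where

open import Defs
open import Data.Nat using (ℕ; zero; suc; _+_; _^_; _≤_; _<_; z≤n; s≤s; _≤?_)
open import Data.Nat.Properties
open import Data.Nat.ListAction using (sum)
open import Data.Nat.ListAction.Properties using (sum-++)
open import Data.Nat.Tactic.RingSolver using (solve-∀)
open import Data.Fin
  using (Fin; zero; suc; toℕ; fromℕ<; inject≤; inject₁; _↑ˡ_; _↑ʳ_; punchOut; finToFun; funToFin)
open import Data.Fin.Patterns using (0F; 1F; 2F; 3F; 4F; 5F)
open import Data.Fin.Properties as Fin using (any?; all?)
open import Data.Bool using (Bool; true; false; if_then_else_; _∧_; not)
import Data.Bool.Properties as Bool
open import Data.List using (List; []; _∷_; [_]; _++_; _ʳ++_; reverse; length; map; lookup)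
open import Data.List.Properties as List
  using (map-cong-local; map-cong; map-++; length-++; ʳ++-defn; reverse-involutive; unfold-reverse)
open import Data.List.Relation.Unary.All as All using (All; []; _∷_)
open import Data.List.Relation.Unary.All.Properties using (¬Any⇒All¬)
open import Data.List.Relation.Unary.Any using (here; there; index)
open import Data.List.Relation.Unary.Any.Properties using (lookup-index)
open import Data.List.Relation.Unary.AllPairs using ([]; _∷_)
open import Data.List.Relation.Unary.Linked using (Linked; []; [-]; _∷_)
open import Data.List.Relation.Unary.Unique.Propositional using (Unique)
open import Data.List.Membership.Propositional using (_∈_; _∉_)
open import Data.List.Membership.Propositional.Properties using (∈-++⁺ʳ; ∈-∃++; ∈-lookup)
import Data.List.Membership.DecPropositional as DecMembership
open import Data.List.Relation.Binary.Permutation.Propositional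
  using (_↭_; ↭-refl; ↭-sym; ↭-trans; prep; swap; ↭⇒↭ₛ)
open import Data.List.Relation.Binary.Permutation.Propositional.Properties
  using (shift; ↭-length; ++⁺ˡ; ++⁺ʳ; ++⁺; ↭-reverse; ++↭ʳ++; ++-comm)
open import Data.List.Relation.Binary.Permutation.Setoid.Properties using (Unique-resp-↭)
open import Data.Vec.Functional using (updateAt)
open import Data.Vec.Functional.Properties using (updateAt-updates; updateAt-minimal)
open import Data.Product using (∃; ∃₂; _×_; _,_; proj₁; proj₂)
open import Data.Sum using (_⊎_; inj₁; inj₂; [_,_]′)
open import Data.Empty using (⊥; ⊥-elim)
open import Function using (_∘_; const)
open import Function.Bundles using (_⇔_; mk⇔)
open import Function.Definitions using (Injective)
open import Relation.Binary.Definitions using (tri<; tri≈; tri>)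
open import Relation.Nullary using (¬_; Dec; yes; no; does)
open import Relation.Nullary.Decidable
  using (¬?; _×-dec_; _⊎-dec_; _→-dec_; map′; from-yes; decidable-stable; dec-true; dec-false)
open import Relation.Binary.PropositionalEquality hiding ([_])

-- Necessity needs two non-traceable graphs only, each with three pendant vertices:
-- the net, which is claw-free, and a clique K on r + 4 vertices joined to three
-- pairwise nonadjacent vertices Xᵢ carrying a pendant Yᵢ each.  In the latter every
-- claw has its leaves in the Xᵢ, which have degree r + 5 in a graph on r + 10
-- vertices, and there is no induced bull.  A connected induced subgraph of the net
-- on at least three vertices is P₃, P₄, C₃, Z₁ or contains the bull.
--
-- For sufficiency call u, v linked if they are adjacent or d(u) + d(v) ≥ n.  By a
-- Bondy–Chvátal exchange, two disjoint paths whose ends are linked can be replaced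
-- by one path with at least as many vertices.  Hence if a longest path P misses x,
-- where x is a neighbour of a vertex c of P, then x and the two ends of P are pairwise
-- unlinked, and c has three neighbours.  In a connected P₄-free graph, or a connected
-- Z₁-free graph with a triangle, three independent vertices have a common neighbour,
-- so the claw condition links two of them.  A triangle-free graph with a vertex of
-- degree at least three turns out to be K_{m,m} minus at most an edge, where again
-- no three vertices are pairwise unlinked.

-- Counting common neighbours

⟦_⟧ : Bool → ℕ
⟦ b ⟧ = if b then 1 else 0

-- Additive on both sides, so that no truncated subtraction arises.
count-updateAt : ∀ {k} (f : Fin k → Bool) l b →
  count k (updateAt f l (const b)) + ⟦ f l ⟧ ≡ count k f + ⟦ b ⟧
count-updateAt f zero b = exchange ⟦ b ⟧ (count _ (f ∘ suc)) ⟦ f zero ⟧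
  where
  exchange : ∀ x y z → (x + y) + z ≡ (z + y) + x
  exchange = solve-∀
count-updateAt {suc k} f (suc l) b = begin
  (⟦ f zero ⟧ + count k (updateAt (f ∘ suc) l (const b))) + ⟦ f (suc l) ⟧
    ≡⟨ +-assoc ⟦ f zero ⟧ _ _ ⟩
  ⟦ f zero ⟧ + (count k (updateAt (f ∘ suc) l (const b)) + ⟦ f (suc l) ⟧)
    ≡⟨ cong (⟦ f zero ⟧ +_) (count-updateAt (f ∘ suc) l b) ⟩
  ⟦ f zero ⟧ + (count k (f ∘ suc) + ⟦ b ⟧)
    ≡⟨ sym (+-assoc ⟦ f zero ⟧ _ _) ⟩
  (⟦ f zero ⟧ + count k (f ∘ suc)) + ⟦ b ⟧ ∎
  where open ≡-Reasoning

module _ {k : ℕ} (f h : Fin k → Bool) where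

  multiplicity : Fin k → ℕ
  multiplicity v = ⟦ f v ⟧ + ⟦ h v ⟧

  Common : Fin k → Set
  Common v = f v ≡ true × h v ≡ true

count-disjoint : ∀ {k} (f h : Fin k → Bool) → (∀ v → ¬ Common f h v) →
  count k f + count k h ≤ k
count-disjoint {zero}  f h disj = z≤n
count-disjoint {suc k} f h disj = begin
  (⟦ f zero ⟧ + count k (f ∘ suc)) + (⟦ h zero ⟧ + count k (h ∘ suc))
    ≡⟨ interchange ⟦ f zero ⟧ (count k (f ∘ suc)) ⟦ h zero ⟧ (count k (h ∘ suc)) ⟩
  (⟦ f zero ⟧ + ⟦ h zero ⟧) + (count k (f ∘ suc) + count k (h ∘ suc))
    ≤⟨ +-mono-≤ (at-most-one (f zero) (h zero) (λ p q → disj zero (p , q)))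
                (count-disjoint (f ∘ suc) (h ∘ suc) (disj ∘ suc)) ⟩
  suc k ∎
  where
  open ≤-Reasoning
  interchange : ∀ a b c d → (a + b) + (c + d) ≡ (a + c) + (b + d)
  interchange = solve-∀
  at-most-one : ∀ x y → (x ≡ true → y ≡ true → ⊥) → ⟦ x ⟧ + ⟦ y ⟧ ≤ 1
  at-most-one true  true  no-both = ⊥-elim (no-both refl refl)
  at-most-one true  false _       = ≤-refl
  at-most-one false true  _       = ≤-refl
  at-most-one false false _       = z≤n

count-disjoint-off : ∀ {k} (f h : Fin k → Bool) L → Unique L →
  (∀ v → v ∉ L → ¬ Common f h v) →
  count k f + count k h + length L ≤ k + sum (map (multiplicity f h) L)
count-disjoint-off {k} f h [] _ disj = begin
  count k f + count k h + 0 ≡⟨ +-identityʳ _ ⟩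
  count k f + count k h     ≤⟨ count-disjoint f h (λ v → disj v (λ ())) ⟩
  k                         ≡⟨ sym (+-identityʳ k) ⟩
  k + 0                     ∎
  where open ≤-Reasoning
-- Replacing the values of f and h at l by true and false makes l disjoint.
count-disjoint-off {k} f h (l ∷ L) (l∉ ∷ uniq) disj = begin
  count k f + count k h + suc (length L)
    ≡⟨ regroup (count k f) (count k h) (length L) ⟩
  (count k f + 1) + (count k h + 0) + length L
    ≡⟨ cong₂ (λ x y → x + y + length L)
             (sym (count-updateAt f l true)) (sym (count-updateAt h l false)) ⟩
  (count k f′ + ⟦ f l ⟧) + (count k h′ + ⟦ h l ⟧) + length L
    ≡⟨ collect (count k f′) ⟦ f l ⟧ (count k h′) ⟦ h l ⟧ (length L) ⟩
  (count k f′ + count k h′ + length L) + multiplicity f h l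
    ≤⟨ +-monoˡ-≤ _ (count-disjoint-off f′ h′ L uniq disj′) ⟩
  (k + sum (map (multiplicity f′ h′) L)) + multiplicity f h l
    ≡⟨ cong (λ x → (k + sum x) + multiplicity f h l) (map-cong-local (All.map unchanged l∉)) ⟩
  (k + sum (map (multiplicity f h) L)) + multiplicity f h l
    ≡⟨ rotate k _ (multiplicity f h l) ⟩
  k + (multiplicity f h l + sum (map (multiplicity f h) L)) ∎
  where
  open ≤-Reasoning
  f′ = updateAt f l (const true)
  h′ = updateAt h l (const false)
  regroup : ∀ a b c → a + b + suc c ≡ (a + 1) + (b + 0) + c
  regroup = solve-∀
  collect : ∀ a b c d e → (a + b) + (c + d) + e ≡ (a + c + e) + (b + d)
  collect = solve-∀
  rotate : ∀ a b c → (a + b) + c ≡ a + (c + b)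
  rotate = solve-∀
  unchanged : ∀ {v} → l ≢ v → multiplicity f′ h′ v ≡ multiplicity f h v
  unchanged {v} l≢v = cong₂ (λ x y → ⟦ x ⟧ + ⟦ y ⟧)
    (updateAt-minimal v l f (≢-sym l≢v)) (updateAt-minimal v l h (≢-sym l≢v))
  disj′ : ∀ v → v ∉ L → ¬ Common f′ h′ v
  disj′ v v∉L (p , q) with v Fin.≟ l
  ... | yes refl with () ← trans (sym (updateAt-updates l h)) q
  ... | no v≢l = disj v
    (λ { (here v≡l) → v≢l v≡l ; (there v∈L) → v∉L v∈L })
    (trans (sym (updateAt-minimal v l f v≢l)) p , trans (sym (updateAt-minimal v l h v≢l)) q)

-- Pigeonhole: without a common point off `L`, each vertex outside `L` adds at most one to the two
-- counts. In use `f` and `h` are neighbourhoods with degree sum at least `k`, so it is enough that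
-- `L` contributes less than its length.
∃-common : ∀ {k} (f h : Fin k → Bool) L → Unique L →
  k + sum (map (multiplicity f h) L) < count k f + count k h + length L →
  ∃ λ v → v ∉ L × Common f h v
∃-common {k} f h L uniq surplus
  with any? (λ v → ¬? (v ∈? L) ×-dec ((f v Bool.≟ true) ×-dec (h v Bool.≟ true)))
  where open DecMembership (Fin._≟_ {k}) using (_∈?_)
... | yes found = found
... | no  none  = ⊥-elim (<⇒≱ surplus
  (count-disjoint-off f h L uniq (λ v v∉L c → none (v , v∉L , c))))

-- Lists without repetition

Unique-↭ : ∀ {A : Set} {xs ys : List A} → xs ↭ ys → Unique xs → Unique ys
Unique-↭ xs↭ys = Unique-resp-↭ (setoid _) (↭⇒↭ₛ xs↭ys)

head∉tail : ∀ {A : Set} {x y : A} {xs} → Unique (x ∷ xs) → y ∈ xs → x ≢ y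
head∉tail (x∉ ∷ _) = All.lookup x∉

reverse-∷ : ∀ {A : Set} (x : A) xs → ∃₂ λ y ys → y ∷ ys ≡ reverse (x ∷ xs)
reverse-∷ x xs with reverse (x ∷ xs) in eq
... | y ∷ ys = y , ys , refl
... | []     with () ← trans (sym (↭-length (↭-reverse (x ∷ xs)))) (cong length eq)

lookup-injective : ∀ {A : Set} {xs : List A} → Unique xs → ∀ {i j} → lookup xs i ≡ lookup xs j → i ≡ j
lookup-injective {xs = _ ∷ _} uniq {zero}  {zero}  _  = refl
lookup-injective {xs = _ ∷ _} uniq {zero}  {suc j} eq = ⊥-elim (head∉tail uniq (∈-lookup j) eq)
lookup-injective {xs = _ ∷ _} uniq {suc i} {zero}  eq = ⊥-elim (head∉tail uniq (∈-lookup i) (sym eq))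
lookup-injective {xs = _ ∷ _} (_ ∷ uniq) {suc i} {suc j} eq = cong suc (lookup-injective uniq eq)

-- Walks and paths as lists

module Paths (G : Graph) where

  V : Set
  V = Fin (n G)

  d : V → ℕ
  d = deg G

  infix 4 _~_ _≁_ _~?_

  _~_ _≁_ : V → V → Set
  u ~ v = adj G u v ≡ true
  u ≁ v = adj G u v ≡ false

  _~?_ : ∀ u v → Dec (u ~ v)
  u ~? v = adj G u v Bool.≟ true

  ~-sym : ∀ {u v} → u ~ v → v ~ u
  ~-sym {u} {v} = trans (adj-sym G v u)

  ≁-sym : ∀ {u v} → u ≁ v → v ≁ u
  ≁-sym {u} {v} = trans (adj-sym G v u)

  ~⇒≢ : ∀ {u v} → u ~ v → u ≢ v
  ~⇒≢ {u} u~u refl with () ← trans (sym u~u) (adj-irrefl G u)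

  ~-≁-⊥ : ∀ {u v} → u ~ v → u ≁ v → ⊥
  ~-≁-⊥ u~v u≁v with () ← trans (sym u~v) u≁v

  ¬~⇒≁ : ∀ {u v} → ¬ (u ~ v) → u ≁ v
  ¬~⇒≁ = Bool.¬-not

  open DecMembership (Fin._≟_ {n G}) using (_∈?_)

  Walk : List V → Set
  Walk = Linked _~_

  IsPath : List V → Set
  IsPath xs = Walk xs × Unique xs

  -- A lower bound instead of an equality, because `exchange` may insert a vertex.
  PathOfLength≥ : ℕ → Set
  PathOfLength≥ k = ∃ λ xs → IsPath xs × k ≤ length xs

  walk-ʳ++ : ∀ {a as b bs} → Walk (a ∷ as) → Walk (b ∷ bs) → a ~ b → Walk ((a ∷ as) ʳ++ (b ∷ bs))
  walk-ʳ++ {as = []}     _           wb a~b = a~b ∷ wb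
  walk-ʳ++ {as = _ ∷ _} (a~a′ ∷ wa) wb a~b = walk-ʳ++ wa (a~b ∷ wb) (~-sym a~a′)

  -- The left arm is stored reversed, so both arms are read outwards from `c`.
  walk-ʳ++⁻ : ∀ ls {c rs} → Walk (ls ʳ++ (c ∷ rs)) → Walk (c ∷ ls) × Walk (c ∷ rs)
  walk-ʳ++⁻ []       w = [-] , w
  walk-ʳ++⁻ (a ∷ as) w with walk-ʳ++⁻ as w
  ... | wa , a~c ∷ wc = ~-sym a~c ∷ wa , wc

  walk-reverse-++ : ∀ ls {c rs} → Walk (c ∷ ls) → Walk (c ∷ rs) → Walk (reverse ls ++ c ∷ rs)
  walk-reverse-++ []       _           wc = wc
  walk-reverse-++ (a ∷ as) (c~a ∷ wa) wc =
    subst Walk (ʳ++-defn (a ∷ as)) (walk-ʳ++ wa wc (~-sym c~a))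

  walk-reverse : ∀ {xs} → Walk xs → Walk (reverse xs)
  walk-reverse {[]}     _ = []
  walk-reverse {a ∷ as} w = subst Walk (sym (unfold-reverse a as)) (walk-reverse-++ as w [-])

  -- The Bondy-Chvátal exchange

  nbrs : V → V → V → ℕ
  nbrs a b = multiplicity (adj G a) (adj G b)

  nbrs-comm : ∀ a b v → nbrs b a v ≡ nbrs a b v
  nbrs-comm a b v = +-comm ⟦ adj G b v ⟧ ⟦ adj G a v ⟧

  HasEndAt : V → List V → Set
  HasEndAt b xs = ∃₂ λ h hs → Walk (h ∷ hs) × b ~ h × h ∷ hs ↭ xs

  -- If b ~ aᵢ and a₁ ~ aᵢ₊₁ then aᵢ ... a₁ aᵢ₊₁ ... aₛ is a path starting at a
  -- neighbour of b; acc is the reversed prefix aᵢ₋₁ ... a₁ and e is aᵢ.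
  rotate-from : ∀ {a b} e acc rs → Walk (e ∷ acc) → Walk (e ∷ rs) →
    (∀ {f xs} → a ~ f → Walk (f ∷ xs) → Walk (e ∷ acc ++ f ∷ xs)) →
    HasEndAt b (e ∷ acc ++ rs) ⊎ ⟦ adj G b e ⟧ + sum (map (nbrs a b) rs) ≤ length rs
  rotate-from {a} {b} e acc [] wl _ _ with adj G b e in be
  ... | true  = inj₁ (e , acc , wl , be , subst (e ∷ acc ↭_) (sym (List.++-identityʳ (e ∷ acc))) ↭-refl)
  ... | false = inj₂ z≤n
  rotate-from {a} {b} e acc (f ∷ rs) wl (e~f ∷ wr) close
    with rotate-from {a} {b} f (e ∷ acc) rs (~-sym e~f ∷ wl) wr (λ a~g w → ~-sym e~f ∷ close a~g w)
  ... | inj₁ (h , hs , w , b~h , perm) =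
    inj₁ (h , hs , w , b~h , ↭-trans perm (↭-sym (shift f (e ∷ acc) rs)))
  ... | inj₂ IH with adj G b e in be | adj G a f in af
  ...   | true  | true  = inj₁ (e , acc ++ f ∷ rs , close af wr , be , ↭-refl)
  ...   | true  | false = inj₂ (s≤s IH)
  ...   | false | true  = inj₂ (s≤s IH)
  ...   | false | false = inj₂ (m≤n⇒m≤1+n IH)

  -- If no rotation starts at a neighbour of `b`, then for each i at most one of b ~ aᵢ and a ~ aᵢ₊₁
  -- holds, and `b` is not adjacent to the last vertex. Pairing the terms this way leaves over only
  -- the zero term a ~ a, so the sum is at most one less than the number of vertices.
  rotate : ∀ {a as} b → Walk (a ∷ as) →
    HasEndAt b (a ∷ as) ⊎ sum (map (nbrs a b) (a ∷ as)) < length (a ∷ as)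
  rotate {a} {as} b w with rotate-from {a} {b} a [] as [-] w (λ a~f wf → a~f ∷ wf)
  ... | inj₁ found = inj₁ found
  ... | inj₂ le rewrite adj-irrefl G a = inj₂ (s≤s le)

  -- If one path can be rotated to start at a neighbour of the other's head, an edge joins the two.
  -- Otherwise both sums from `rotate` are small, so the degree sum forces a common neighbour `z` of
  -- `a` and `b` outside both paths, and `z` is inserted between them.
  exchange : ∀ {a as b bs} → Walk (a ∷ as) → Walk (b ∷ bs) → Unique (a ∷ as ++ b ∷ bs) →
    n G ≤ d a + d b → PathOfLength≥ (length (a ∷ as ++ b ∷ bs))
  exchange {a} {as} {b} {bs} wa wb uniq heavy with rotate b wa | rotate a wb
  ... | inj₁ (h , hs , w , b~h , perm) | _ =
    (h ∷ hs) ʳ++ (b ∷ bs) , (walk-ʳ++ w wb (~-sym b~h) , Unique-↭ perm′ uniq) , ≤-reflexive (↭-length perm′)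
    where
    perm′ : a ∷ as ++ b ∷ bs ↭ (h ∷ hs) ʳ++ (b ∷ bs)
    perm′ = ↭-trans (++⁺ʳ (b ∷ bs) (↭-sym perm)) (++↭ʳ++ (h ∷ hs) (b ∷ bs))
  ... | inj₂ _ | inj₁ (h , hs , w , a~h , perm) =
    (a ∷ as) ʳ++ (h ∷ hs) , (walk-ʳ++ wa w a~h , Unique-↭ perm′ uniq) , ≤-reflexive (↭-length perm′)
    where
    perm′ : a ∷ as ++ b ∷ bs ↭ (a ∷ as) ʳ++ (h ∷ hs)
    perm′ = ↭-trans (++⁺ˡ (a ∷ as) (↭-sym perm)) (++↭ʳ++ (a ∷ as) (h ∷ hs))
  ... | inj₂ Σa< | inj₂ Σb< = insert (∃-common (adj G a) (adj G b) L uniq surplus)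
    where
    L = a ∷ as ++ b ∷ bs
    ΣL< : sum (map (nbrs a b) L) < length L
    ΣL< = begin-strict
      sum (map (nbrs a b) L)
        ≡⟨ cong sum (map-++ (nbrs a b) (a ∷ as) (b ∷ bs)) ⟩
      sum (map (nbrs a b) (a ∷ as) ++ map (nbrs a b) (b ∷ bs))
        ≡⟨ sum-++ (map (nbrs a b) (a ∷ as)) (map (nbrs a b) (b ∷ bs)) ⟩
      sum (map (nbrs a b) (a ∷ as)) + sum (map (nbrs a b) (b ∷ bs))
        ≡⟨ cong (λ x → sum (map (nbrs a b) (a ∷ as)) + sum x) (map-cong (nbrs-comm b a) (b ∷ bs)) ⟩
      sum (map (nbrs a b) (a ∷ as)) + sum (map (nbrs b a) (b ∷ bs))
        <⟨ +-mono-< Σa< Σb< ⟩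
      length (a ∷ as) + length (b ∷ bs)
        ≡⟨ sym (length-++ (a ∷ as)) ⟩
      length L ∎
      where open ≤-Reasoning
    surplus : n G + sum (map (nbrs a b) L) < d a + d b + length L
    surplus = +-mono-≤-< heavy ΣL<
    insert : (∃ λ z → z ∉ L × Common (adj G a) (adj G b) z) → PathOfLength≥ (length L)
    insert (z , z∉L , a~z , b~z) =
      (a ∷ as) ʳ++ (z ∷ b ∷ bs) ,
      (walk-ʳ++ wa (~-sym b~z ∷ wb) a~z , Unique-↭ perm′ (¬Any⇒All¬ L z∉L ∷ uniq)) ,
      ≤-trans (n≤1+n _) (≤-reflexive (↭-length perm′))
      where
      perm′ : z ∷ L ↭ (a ∷ as) ʳ++ (z ∷ b ∷ bs)
      perm′ = ↭-trans (↭-sym (shift z (a ∷ as) (b ∷ bs))) (++↭ʳ++ (a ∷ as) (z ∷ b ∷ bs))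

  Heavy : V → V → Set
  Heavy u v = n G ≤ d u + d v

  Heavy-sym : ∀ {u v} → Heavy u v → Heavy v u
  Heavy-sym {u} {v} = subst (n G ≤_) (+-comm (d u) (d v))

  Link : V → V → Set
  Link u v = u ~ v ⊎ Heavy u v

  link? : ∀ u v → Dec (Link u v)
  link? u v = (u ~? v) ⊎-dec (n G ≤? d u + d v)

  join : ∀ {a as b bs} → Walk (a ∷ as) → Walk (b ∷ bs) → Unique (a ∷ as ++ b ∷ bs) →
    Link a b → PathOfLength≥ (length (a ∷ as ++ b ∷ bs))
  join {a} {as} {b} {bs} wa wb uniq (inj₁ a~b) =
    (a ∷ as) ʳ++ (b ∷ bs) , (walk-ʳ++ wa wb a~b , Unique-↭ perm uniq) , ≤-reflexive (↭-length perm)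
    where
    perm : a ∷ as ++ b ∷ bs ↭ (a ∷ as) ʳ++ (b ∷ bs)
    perm = ++↭ʳ++ (a ∷ as) (b ∷ bs)
  join wa wb uniq (inj₂ heavy) = exchange wa wb uniq heavy

  -- Growing a path to a Hamiltonian one

  record Scattered (s t r : V) : Set where
    field
      s≢t : s ≢ t
      s≢r : s ≢ r
      t≢r : t ≢ r
      ¬st : ¬ Link s t
      ¬sr : ¬ Link s r
      ¬tr : ¬ Link t r

  record Fork (c : V) : Set where
    field
      {a₁ a₂ a₃} : V
      c~₁ : c ~ a₁
      c~₂ : c ~ a₂
      c~₃ : c ~ a₃
      a₁≢a₂ : a₁ ≢ a₂
      a₁≢a₃ : a₁ ≢ a₃
      a₂≢a₃ : a₂ ≢ a₃

  -- The obstruction met by a path that cannot grow never occurs: the fork consists of a missed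
  -- vertex and the two path neighbours of `c`, the scattered triple of the missed vertex and the
  -- two ends of the path.
  Sparse : Set
  Sparse = ∀ {c s t r} → Fork c → ¬ Scattered s t r

  -- `ls` and `rs` are the arms of the path at `c`, so reversing them brings its ends `u` and `w` to
  -- the front. If an arm is empty, `c` is an end and `x` is attached to it. Otherwise `sparse`
  -- forces a link among `x`, `u`, `w`, and for each such link the vertices split into two paths
  -- that start at the linked vertices.
  extend-at : Sparse → ∀ {x c} ls rs → x ~ c → Walk (c ∷ ls) → Walk (c ∷ rs) →
    Unique (x ∷ c ∷ ls ++ rs) → PathOfLength≥ (length (x ∷ c ∷ ls ++ rs))
  extend-at _ {x} {c} [] rs x~c _ wr uniq = x ∷ c ∷ rs , (x~c ∷ wr , uniq) , ≤-refl
  extend-at _ {x} {c} (a ∷ as) [] x~c wl _ uniq =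
    x ∷ c ∷ a ∷ as , (x~c ∷ wl , Unique-↭ perm uniq) , ≤-reflexive (↭-length perm)
    where
    perm : x ∷ c ∷ (a ∷ as) ++ [] ↭ x ∷ c ∷ a ∷ as
    perm = prep x (prep c (++-comm (a ∷ as) []))
  extend-at sparse {x} {c} ls@(a ∷ as) rs@(b ∷ bs) x~c wl@(c~a ∷ wa) wr@(c~b ∷ wb) uniq
    with reverse-∷ a as | reverse-∷ b bs
  ... | u , us , eqᵤ | w , ws , eq_w = decide (link? x u) (link? x w) (link? w u)
    where
    Goal = PathOfLength≥ (length (x ∷ c ∷ ls ++ rs))
    viaJoin : ∀ {e es f fs} → Walk (e ∷ es) → Walk (f ∷ fs) → Link e f →
      e ∷ es ++ f ∷ fs ↭ x ∷ c ∷ ls ++ rs → Goal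
    viaJoin we wf l perm = subst PathOfLength≥ (↭-length perm) (join we wf (Unique-↭ (↭-sym perm) uniq) l)
    wᵤ : Walk (u ∷ us ++ c ∷ rs)
    wᵤ = subst (λ z → Walk (z ++ c ∷ rs)) (sym eqᵤ) (walk-reverse-++ ls wl wr)
    w_w : Walk (w ∷ ws ++ c ∷ ls)
    w_w = subst (λ z → Walk (z ++ c ∷ ls)) (sym eq_w) (walk-reverse-++ rs wr wl)
    permᵤ : u ∷ us ↭ ls
    permᵤ = subst (_↭ ls) (sym eqᵤ) (↭-reverse ls)
    perm_w : w ∷ ws ↭ rs
    perm_w = subst (_↭ rs) (sym eq_w) (↭-reverse rs)
    ends : Unique (x ∷ c ∷ (u ∷ us) ++ (w ∷ ws))
    ends = Unique-↭ (prep x (prep c (++⁺ (↭-sym permᵤ) (↭-sym perm_w)))) uniq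
    decide : Dec (Link x u) → Dec (Link x w) → Dec (Link w u) → Goal
    decide (yes xu) _ _ = viaJoin [-] wᵤ xu
      (prep x (↭-trans (shift c (u ∷ us) rs) (prep c (++⁺ʳ rs permᵤ))))
    decide _ (yes xw) _ = viaJoin [-] w_w xw
      (prep x (↭-trans (shift c (w ∷ ws) ls) (prep c (↭-trans (++⁺ʳ ls perm_w) (++-comm rs ls)))))
    -- The path is cut between `c` and `a`, and `x` is hung on `c`: one part runs from `w` to `x`,
    -- the other from `u` to `a`.
    decide _ _ (yes wu) = viaJoin
      (subst (λ z → Walk (z ++ c ∷ [ x ])) (sym eq_w) (walk-reverse-++ rs wr (~-sym x~c ∷ [-])))
      (subst Walk (sym eqᵤ) (walk-reverse wa)) wu perm
      where
      perm : (w ∷ ws ++ c ∷ [ x ]) ++ u ∷ us ↭ x ∷ c ∷ ls ++ rs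
      perm = ↭-trans (++-comm (w ∷ ws ++ c ∷ [ x ]) (u ∷ us))
        (↭-trans (++⁺ permᵤ (↭-trans (++⁺ʳ (c ∷ [ x ]) perm_w) (++-comm rs (c ∷ [ x ]))))
        (↭-trans (shift c ls (x ∷ rs))
        (↭-trans (prep c (shift x ls rs))
        (swap c x ↭-refl))))
    decide (no ¬xu) (no ¬xw) (no ¬wu) = ⊥-elim (sparse
      (record { c~₁ = ~-sym x~c ; c~₂ = c~a ; c~₃ = c~b
              ; a₁≢a₂ = head∉tail uniq (there (here refl))
              ; a₁≢a₃ = head∉tail uniq (there (∈-++⁺ʳ ls (here refl)))
              ; a₂≢a₃ = inside uniq })
      (record { s≢t = head∉tail ends (there (here refl))
              ; s≢r = head∉tail ends (there (∈-++⁺ʳ (u ∷ us) (here refl)))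
              ; t≢r = inside ends
              ; ¬st = ¬xu ; ¬sr = ¬xw
              ; ¬tr = ¬wu ∘ [ inj₁ ∘ ~-sym , inj₂ ∘ Heavy-sym {u} {w} ]′ }))
      where
      inside : ∀ {p ps q qs} → Unique (x ∷ c ∷ (p ∷ ps) ++ (q ∷ qs)) → p ≢ q
      inside {ps = ps} (_ ∷ _ ∷ un) = head∉tail un (∈-++⁺ʳ ps (here refl))

  crossing : ∀ {xs u v} → Reach G u v → u ∈ xs → v ∉ xs → ∃₂ λ c x → c ∈ xs × x ∉ xs × c ~ x
  crossing here u∈ v∉ = ⊥-elim (v∉ u∈)
  crossing {xs} (step {u} {w} u~w r) u∈ v∉ with w ∈? xs
  ... | yes w∈ = crossing r w∈ v∉
  ... | no  w∉ = u , w , u∈ , w∉ , u~w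

  -- If every vertex occurred, sending it to its position would inject `V` into `Fin (length xs)`.
  ∃-missing : ∀ xs → length xs < n G → ∃ λ v → v ∉ xs
  ∃-missing xs short with any? (λ v → ¬? (v ∈? xs))
  ... | yes found = found
  ... | no  none  = ⊥-elim (<⇒≱ short (Fin.injective⇒≤ {f = index ∘ mem} index-injective))
    where
    mem : ∀ v → v ∈ xs
    mem v = decidable-stable (v ∈? xs) (λ v∉ → none (v , v∉))
    index-injective : ∀ {v w} → index (mem v) ≡ index (mem w) → v ≡ w
    index-injective {v} {w} eq = trans (lookup-index (mem v))
      (trans (cong (lookup xs) eq) (sym (lookup-index (mem w))))

  -- By connectedness some edge `c ~ x` leaves the path; opening the path at `c` into its two arms
  -- gives the situation of `extend-at`.
  extend : Connected G → Sparse → ∀ xs → IsPath xs → length xs < n G → PathOfLength≥ (suc (length xs))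
  extend conn sparse [] _ short = [ fromℕ< short ] , ([-] , [] ∷ []) , ≤-refl
  extend conn sparse (v ∷ vs) (walk , uniq) short with ∃-missing (v ∷ vs) short
  ... | y , y∉ with crossing (conn v y) (here refl) y∉
  ...   | c , x , c∈ , x∉ , c~x with ∈-∃++ c∈
  ...     | ps , rs , eq = subst PathOfLength≥ (cong suc (sym (↭-length perm)))
      (extend-at sparse (reverse ps) rs (~-sym c~x) (proj₁ walks) (proj₂ walks)
        (Unique-↭ (prep x perm) (¬Any⇒All¬ (v ∷ vs) x∉ ∷ uniq)))
    where
    zipper : v ∷ vs ≡ reverse ps ʳ++ (c ∷ rs)
    zipper = trans eq (trans (cong (_++ c ∷ rs) (sym (reverse-involutive ps))) (sym (ʳ++-defn (reverse ps))))
    walks = walk-ʳ++⁻ (reverse ps) (subst Walk zipper walk)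
    perm : v ∷ vs ↭ c ∷ reverse ps ++ rs
    perm = subst (_↭ c ∷ reverse ps ++ rs) (sym zipper)
      (↭-trans (↭-sym (++↭ʳ++ (reverse ps) (c ∷ rs))) (shift c (reverse ps) rs))

  walk-lookup : ∀ {xs} → Walk xs → ∀ i j → toℕ j ≡ suc (toℕ i) → lookup xs i ~ lookup xs j
  walk-lookup (a~b ∷ w) zero (suc zero) _ = a~b
  walk-lookup (_ ∷ w) (suc i) (suc j) eq = walk-lookup w i j (suc-injective eq)
  walk-lookup [-] zero zero ()
  walk-lookup (_ ∷ _) zero zero ()
  walk-lookup (_ ∷ _) zero (suc (suc _)) ()
  walk-lookup (_ ∷ _) (suc _) zero ()

  hamiltonian⇒traceable : ∀ xs → IsPath xs → n G ≤ length xs → Traceable G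
  hamiltonian⇒traceable xs (walk , uniq) long =
    lookup xs ∘ pos ,
    (λ {i} {j} eq → Fin.inject≤-injective long long i j (lookup-injective uniq eq)) ,
    (λ i j eq → walk-lookup walk (pos i) (pos j)
      (trans (Fin.toℕ-inject≤ j long) (trans eq (cong suc (sym (Fin.toℕ-inject≤ i long))))))
    where
    pos : V → Fin (length xs)
    pos i = inject≤ i long

  sparse⇒traceable : Connected G → Sparse → Traceable G
  -- The fuel bounds the number of vertices still missed, and every extension gains at least one.
  sparse⇒traceable conn sparse = grow (n G) [] ([] , []) (m≤n+m (n G) 0)
    where
    grow : ∀ fuel xs → IsPath xs → n G ≤ length xs + fuel → Traceable G
    grow fuel xs p bound with n G ≤? length xs
    ... | yes long = hamiltonian⇒traceable xs p long
    grow zero xs p bound | no short = ⊥-elim (short (subst (n G ≤_) (+-identityʳ _) bound))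
    grow (suc fuel) xs p bound | no short with extend conn sparse xs p (≰⇒> short)
    ... | ys , q , longer = grow fuel ys q (≤-trans bound
      (subst (_≤ length ys + fuel) (sym (+-suc (length xs) fuel)) (+-monoˡ-≤ fuel longer)))

-- Induced copies of graphs on four vertices

quad : ∀ {A : Set} → A → A → A → A → Fin 4 → A
quad a b c e 0F = a
quad a b c e 1F = b
quad a b c e 2F = c
quad a b c e 3F = e

-- Supplies the hypothesis of `induced-copy` from the six pairs of a graph on four vertices.
upper-triangle : ∀ {P : Fin 4 → Fin 4 → Set} →
  P 0F 1F → P 0F 2F → P 0F 3F → P 1F 2F → P 1F 3F → P 2F 3F → ∀ {i j} → i Data.Fin.< j → P i j
upper-triangle p01 p02 p03 p12 p13 p23 {0F} {1F} _ = p01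
upper-triangle p01 p02 p03 p12 p13 p23 {0F} {2F} _ = p02
upper-triangle p01 p02 p03 p12 p13 p23 {0F} {3F} _ = p03
upper-triangle p01 p02 p03 p12 p13 p23 {1F} {2F} _ = p12
upper-triangle p01 p02 p03 p12 p13 p23 {1F} {3F} _ = p13
upper-triangle p01 p02 p03 p12 p13 p23 {2F} {3F} _ = p23
upper-triangle p01 p02 p03 p12 p13 p23 {1F} {1F} (s≤s ())
upper-triangle p01 p02 p03 p12 p13 p23 {2F} {1F} (s≤s ())
upper-triangle p01 p02 p03 p12 p13 p23 {2F} {2F} (s≤s (s≤s ()))
upper-triangle p01 p02 p03 p12 p13 p23 {3F} {1F} (s≤s ())
upper-triangle p01 p02 p03 p12 p13 p23 {3F} {2F} (s≤s (s≤s ()))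
upper-triangle p01 p02 p03 p12 p13 p23 {3F} {3F} (s≤s (s≤s (s≤s ())))

-- Both adjacencies are symmetric and irreflexive, which settles the pairs with `j` at most `i`.
induced-copy : ∀ (H G : Graph) f →
  (∀ {i j} → i Data.Fin.< j → f i ≢ f j × adj G (f i) (f j) ≡ adj H i j) → InducedCopy H G f
induced-copy H G f upper = injective , adjacency
  where
  injective : ∀ {i j} → f i ≡ f j → i ≡ j
  injective {i} {j} eq with Fin.<-cmp i j
  ... | tri< i<j _ _ = ⊥-elim (proj₁ (upper i<j) eq)
  ... | tri≈ _ i≡j _ = i≡j
  ... | tri> _ _ j<i = ⊥-elim (proj₁ (upper j<i) (sym eq))
  adjacency : ∀ i j → adj G (f i) (f j) ≡ adj H i j
  adjacency i j with Fin.<-cmp i j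
  ... | tri< i<j _ _  = proj₂ (upper i<j)
  ... | tri≈ _ refl _ = trans (adj-irrefl G (f i)) (sym (adj-irrefl H i))
  ... | tri> _ _ j<i  = trans (adj-sym G (f i) (f j)) (trans (proj₂ (upper j<i)) (adj-sym H j i))

-- Sufficiency: claws and scattered triples

module HeavyClaws (G : Graph) (conn : Connected G) {r : ℕ} (clawHeavy : ClawHeavy r G) where

  open Paths G

  claw⇒heavy : ∀ {c p q s} → c ~ p → c ~ q → c ~ s → p ≢ q → p ≢ s → q ≢ s →
    p ≁ q → p ≁ s → q ≁ s → Heavy p q ⊎ Heavy p s ⊎ Heavy q s
  claw⇒heavy {c} {p} {q} {s} cp cq cs p≢q p≢s q≢s pq ps qs
    with clawHeavy (quad c p q s) (induced-copy Claw G (quad c p q s) (upper-triangle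
      {P = λ i j → quad c p q s i ≢ quad c p q s j × adj G (quad c p q s i) (quad c p q s j) ≡ adj Claw i j}
      (~⇒≢ cp , cp) (~⇒≢ cq , cq) (~⇒≢ cs , cs) (p≢q , pq) (p≢s , ps) (q≢s , qs)))
  -- The bound `n G + r` is weakened to `n G`, so that what follows is uniform in `r`. The
  -- nonadjacent pair cannot contain the centre, hence consists of two leaves.
  ... | i , j , i≢j , i≁j , bound = select i j i≢j i≁j (m+n≤o⇒m≤o (n G) bound)
    where
    f = quad c p q s
    select : ∀ i j → i ≢ j → f i ≁ f j → Heavy (f i) (f j) → Heavy p q ⊎ Heavy p s ⊎ Heavy q s
    select 0F 0F i≢j _ _ = ⊥-elim (i≢j refl)
    select 1F 1F i≢j _ _ = ⊥-elim (i≢j refl)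
    select 2F 2F i≢j _ _ = ⊥-elim (i≢j refl)
    select 3F 3F i≢j _ _ = ⊥-elim (i≢j refl)
    select 0F 1F _ c≁p _ = ⊥-elim (~-≁-⊥ cp c≁p)
    select 0F 2F _ c≁q _ = ⊥-elim (~-≁-⊥ cq c≁q)
    select 0F 3F _ c≁s _ = ⊥-elim (~-≁-⊥ cs c≁s)
    select 1F 0F _ p≁c _ = ⊥-elim (~-≁-⊥ cp (≁-sym p≁c))
    select 2F 0F _ q≁c _ = ⊥-elim (~-≁-⊥ cq (≁-sym q≁c))
    select 3F 0F _ s≁c _ = ⊥-elim (~-≁-⊥ cs (≁-sym s≁c))
    select 1F 2F _ _ h = inj₁ h
    select 1F 3F _ _ h = inj₂ (inj₁ h)
    select 2F 3F _ _ h = inj₂ (inj₂ h)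
    select 2F 1F _ _ h = inj₁ (Heavy-sym {q} {p} h)
    select 3F 1F _ _ h = inj₂ (inj₁ (Heavy-sym {s} {p} h))
    select 3F 2F _ _ h = inj₂ (inj₂ (Heavy-sym {s} {q} h))

  ¬Link⇒≁ : ∀ {u v} → ¬ Link u v → u ≁ v
  ¬Link⇒≁ ¬l = ¬~⇒≁ (¬l ∘ inj₁)

  -- The three vertices would be the leaves of a claw at `c`, and its heavy pair would be a link.
  scattered-no-center : ∀ {c s t r} → Scattered s t r → c ~ s → c ~ t → c ~ r → ⊥
  scattered-no-center sc cs ct cr
    with claw⇒heavy cs ct cr s≢t s≢r t≢r (¬Link⇒≁ ¬st) (¬Link⇒≁ ¬sr) (¬Link⇒≁ ¬tr)
    where open Scattered sc
  ... | inj₁ h        = Scattered.¬st sc (inj₂ h)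
  ... | inj₂ (inj₁ h) = Scattered.¬sr sc (inj₂ h)
  ... | inj₂ (inj₂ h) = Scattered.¬tr sc (inj₂ h)

  Link-sym : ∀ {u v} → Link u v → Link v u
  Link-sym {u} {v} = [ inj₁ ∘ ~-sym , inj₂ ∘ Heavy-sym {u} {v} ]′

  scattered-swap : ∀ {s t r} → Scattered s t r → Scattered t s r
  scattered-swap sc = record
    { s≢t = ≢-sym s≢t ; s≢r = t≢r ; t≢r = s≢r ; ¬st = ¬st ∘ Link-sym ; ¬sr = ¬tr ; ¬tr = ¬sr }
    where open Scattered sc

  scattered-rotate : ∀ {s t r} → Scattered s t r → Scattered t r s
  scattered-rotate sc = record
    { s≢t = t≢r ; s≢r = ≢-sym s≢t ; t≢r = ≢-sym s≢r
    ; ¬st = ¬tr ; ¬sr = ¬st ∘ Link-sym ; ¬tr = ¬sr ∘ Link-sym }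
    where open Scattered sc

  -- Sufficiency for P₄

  module P4Free (free : Free P4 G) where

    no-P4 : ∀ {a b c e} → a ~ b → b ~ c → c ~ e → a ≁ c → a ≁ e → ¬ b ≁ e
    no-P4 {a} {b} {c} {e} ab bc ce a≁c a≁e b≁e = free f (induced-copy P4 G f (upper-triangle
      {P = λ i j → f i ≢ f j × adj G (f i) (f j) ≡ adj P4 i j}
      (~⇒≢ ab , ab)
      ((λ { refl → ~-≁-⊥ ce a≁e }) , a≁c)
      ((λ { refl → ~-≁-⊥ ab (≁-sym b≁e) }) , a≁e)
      (~⇒≢ bc , bc)
      ((λ { refl → ~-≁-⊥ ab a≁e }) , b≁e)
      (~⇒≢ ce , ce)))
      where f = quad a b c e

    -- A walk of three steps without a shortcut would be an induced P₄.
    distance≤2 : ∀ {u w} → Reach G u w → u ≡ w ⊎ u ~ w ⊎ ∃ λ z → u ~ z × z ~ w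
    distance≤2 here = inj₁ refl
    distance≤2 (step {u} {v} {w} uv vw) with distance≤2 vw
    ... | inj₁ refl = inj₂ (inj₁ uv)
    ... | inj₂ (inj₁ v~w) = inj₂ (inj₂ (v , uv , v~w))
    ... | inj₂ (inj₂ (z , vz , zw)) with u ~? w | u ~? z | v ~? w
    ...   | yes uw | _      | _      = inj₂ (inj₁ uw)
    ...   | _      | yes uz | _      = inj₂ (inj₂ (z , uz , zw))
    ...   | _      | _      | yes vw = inj₂ (inj₂ (v , uv , vw))
    ...   | no ¬uw | no ¬uz | no ¬vw = ⊥-elim (no-P4 uv vz zw (¬~⇒≁ ¬uz) (¬~⇒≁ ¬uw) (¬~⇒≁ ¬vw))

    common-neighbour : ∀ {s t} → s ≢ t → s ≁ t → ∃ λ z → s ~ z × z ~ t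
    common-neighbour {s} {t} s≢t s≁t with distance≤2 (conn s t)
    ... | inj₁ s≡t          = ⊥-elim (s≢t s≡t)
    ... | inj₂ (inj₁ s~t)   = ⊥-elim (~-≁-⊥ s~t s≁t)
    ... | inj₂ (inj₂ found) = found

    -- Let `z` be a common neighbour of `s` and `t`. If `z` misses `r`, a common neighbour `y` of
    -- `z` and `r` is adjacent to `s` and `t` as well: otherwise s z y r or t z y r is an induced
    -- P₄. So `z` or `y` is adjacent to all three.
    not-scattered : ∀ {s t r} → ¬ Scattered s t r
    not-scattered {s} {t} {r} sc with common-neighbour s≢t (¬Link⇒≁ ¬st)
      where open Scattered sc
    ... | z , sz , zt with z ~? r
    ...   | yes zr = scattered-no-center sc (~-sym sz) zt zr
    ...   | no ¬zr with common-neighbour (λ { refl → Scattered.¬sr sc (inj₁ sz) }) (¬~⇒≁ ¬zr)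
    ...     | y , zy , yr =
      scattered-no-center sc (near sz (Scattered.¬sr sc)) (near (~-sym zt) (Scattered.¬tr sc)) yr
      where
      near : ∀ {p} → p ~ z → ¬ Link p r → y ~ p
      near {p} pz ¬pr with y ~? p
      ... | yes yp = yp
      ... | no ¬yp = ⊥-elim (no-P4 pz zy yr (≁-sym (¬~⇒≁ ¬yp)) (¬Link⇒≁ ¬pr) (¬~⇒≁ ¬zr))

    traceable : Traceable G
    traceable = sparse⇒traceable conn (λ _ → not-scattered)

  -- Sufficiency for triangle-free graphs

  record Triangle (p q t : V) : Set where
    constructor triangle
    field
      pq : p ~ q
      pt : p ~ t
      qt : q ~ t

  module TriangleFree (tf : ∀ {p q t} → ¬ Triangle p q t) where

    siblings-≁ : ∀ {c u v} → c ~ u → c ~ v → u ≁ v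
    siblings-≁ cu cv = ¬~⇒≁ (λ uv → tf (triangle cu cv uv))

    edge-sum≤n : ∀ {u v} → u ~ v → d u + d v ≤ n G
    edge-sum≤n {u} {v} uv = count-disjoint (adj G u) (adj G v) (λ z (uz , vz) → tf (triangle uv uz vz))

    -- The neighbourhoods of `u` and `v` are disjoint, so with degree sum n they exhaust all
    -- vertices.
    heavy-edge-dominates : ∀ {u v} → u ~ v → Heavy u v → ∀ w → w ~ u ⊎ w ~ v
    heavy-edge-dominates {u} {v} uv heavy w with w ~? u | w ~? v
    ... | yes wu | _      = inj₁ wu
    ... | _      | yes wv = inj₂ wv
    ... | no ¬wu | no ¬wv with ∃-common (adj G u) (adj G v) [ w ] ([] ∷ []) surplus
      where
      surplus : n G + sum (map (nbrs u v) [ w ]) < d u + d v + 1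
      surplus rewrite ≁-sym (¬~⇒≁ ¬wu) | ≁-sym (¬~⇒≁ ¬wv) = +-mono-≤-< heavy (s≤s z≤n)
    ...   | z , _ , uz , vz = ⊥-elim (tf (triangle uv uz vz))

    claw : ∀ {c p q s} → c ~ p → c ~ q → c ~ s → p ≢ q → p ≢ s → q ≢ s →
      Heavy p q ⊎ Heavy p s ⊎ Heavy q s
    claw cp cq cs p≢q p≢s q≢s =
      claw⇒heavy cp cq cs p≢q p≢s q≢s (siblings-≁ cp cq) (siblings-≁ cp cs) (siblings-≁ cq cs)

    -- As d(u) + d(v) ≥ n, there are at least as many common neighbours of `u` and `v` as vertices
    -- adjacent to neither. The vertices `u`, `v`, `w` are of the latter kind, so besides `c` there
    -- are two more common neighbours `z` and `y`.
    two-forks : ∀ {c u v w} → c ~ u → c ~ v → c ~ w → u ≢ v → u ≢ w → v ≢ w → Heavy u v → Fork u × Fork v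
    two-forks {c} {u} {v} {w} cu cv cw u≢v u≢w v≢w heavy =
      second (∃-common (adj G u) (adj G v) L uniq
        (+-mono-≤-< heavy (s≤s (≤-trans (+-mono-≤ (nbrs≤2 c) (≤-reflexive none)) (s≤s (s≤s z≤n))))))
      where
      L = c ∷ u ∷ v ∷ w ∷ []
      uniq : Unique L
      uniq = (~⇒≢ cu ∷ ~⇒≢ cv ∷ ~⇒≢ cw ∷ []) ∷ (u≢v ∷ u≢w ∷ []) ∷ (v≢w ∷ []) ∷ [] ∷ []
      none : sum (map (nbrs u v) (u ∷ v ∷ w ∷ [])) ≡ 0
      none rewrite adj-irrefl G u | adj-irrefl G v | siblings-≁ cu cv | siblings-≁ cv cu
                 | siblings-≁ cu cw | siblings-≁ cv cw = refl
      nbrs≤2 : ∀ z → nbrs u v z ≤ 2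
      nbrs≤2 z = +-mono-≤ (bit (adj G u z)) (bit (adj G v z))
        where
        bit : ∀ b → ⟦ b ⟧ ≤ 1
        bit true  = ≤-refl
        bit false = z≤n
      second : (∃ λ z → z ∉ L × Common (adj G u) (adj G v) z) → Fork u × Fork v
      -- `z` and `c` contribute at most two each and `u`, `v`, `w` nothing: at most four on a list
      -- of length five.
      second (z , z∉ , uz , vz) = third (∃-common (adj G u) (adj G v) (z ∷ L) (¬Any⇒All¬ L z∉ ∷ uniq)
        (+-mono-≤-< heavy (s≤s (+-mono-≤ (nbrs≤2 z) (+-mono-≤ (nbrs≤2 c) (≤-reflexive none))))))
        where
        third : (∃ λ y → y ∉ z ∷ L × Common (adj G u) (adj G v) y) → Fork u × Fork v
        third (y , y∉ , uy , vy) = fork (~-sym cu) uz uy , fork (~-sym cv) vz vy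
          where
          fork : ∀ {x} → x ~ c → x ~ z → x ~ y → Fork x
          fork xc xz xy = record
            { c~₁ = xc ; c~₂ = xz ; c~₃ = xy
            ; a₁≢a₂ = λ { refl → z∉ (here refl) }
            ; a₁≢a₃ = λ { refl → y∉ (there (here refl)) }
            ; a₂≢a₃ = λ { refl → y∉ (here refl) } }

    -- Degree at least n/2, expressed without division.
    Big : V → Set
    Big u = Heavy u u

    heavy⇒big : ∀ {u v} → Heavy u v → Big u ⊎ Big v
    heavy⇒big {u} {v} heavy with ≤-total (d u) (d v)
    ... | inj₁ u≤v = inj₂ (≤-trans heavy (+-monoˡ-≤ (d v) u≤v))
    ... | inj₂ v≤u = inj₁ (≤-trans heavy (+-monoʳ-≤ (d u) v≤u))

    big⇒heavy : ∀ {u v} → Big u → Big v → Heavy u v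
    big⇒heavy {u} {v} big-u big-v with ≤-total (d u) (d v)
    ... | inj₁ u≤v = ≤-trans big-u (+-monoʳ-≤ (d u) u≤v)
    ... | inj₂ v≤u = ≤-trans big-v (+-monoˡ-≤ (d v) v≤u)

    -- Without triangles a fork is a claw, and one member of its heavy pair has degree at least n/2.
    fork⇒big-nbr : ∀ {u} → Fork u → ∃ λ y → u ~ y × Big y
    fork⇒big-nbr fork with claw c~₁ c~₂ c~₃ a₁≢a₂ a₁≢a₃ a₂≢a₃
      where open Fork fork
    ... | inj₁ h        = [ (λ b → _ , Fork.c~₁ fork , b) , (λ b → _ , Fork.c~₂ fork , b) ]′ (heavy⇒big h)
    ... | inj₂ (inj₁ h) = [ (λ b → _ , Fork.c~₁ fork , b) , (λ b → _ , Fork.c~₃ fork , b) ]′ (heavy⇒big h)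
    ... | inj₂ (inj₂ h) = [ (λ b → _ , Fork.c~₂ fork , b) , (λ b → _ , Fork.c~₃ fork , b) ]′ (heavy⇒big h)

    -- A neighbour `x` of `u` has d(x) + d(u) ≤ n ≤ 2d(u), so d(x) ≤ d(u). The fork provides a third
    -- neighbour of `u`; the heavy pair of the resulting claw contains `s` or `t`, and its other
    -- member may be replaced by `u`.
    full-or-full : ∀ {u} → Big u → Fork u → ∀ {s t} → u ~ s → u ~ t → s ≢ t → Heavy s u ⊎ Heavy t u
    full-or-full {u} big nu {s} {t} us ut s≢t = pick (a₁ Fin.≟ s) (a₁ Fin.≟ t) (a₂ Fin.≟ s) (a₂ Fin.≟ t)
      where
      open Fork nu
      d≤u : ∀ {x} → u ~ x → d x ≤ d u
      d≤u {x} ux = +-cancelˡ-≤ (d u) _ _ (≤-trans (edge-sum≤n ux) big)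
      full : ∀ {x y} → u ~ y → Heavy x y → Heavy x u
      full {x} uy h = ≤-trans h (+-monoʳ-≤ (d x) (d≤u uy))
      with-third : ∀ {z} → u ~ z → z ≢ s → z ≢ t → Heavy s u ⊎ Heavy t u
      with-third uz z≢s z≢t with claw us ut uz s≢t (≢-sym z≢s) (≢-sym z≢t)
      ... | inj₁ st        = inj₁ (full ut st)
      ... | inj₂ (inj₁ sz) = inj₁ (full uz sz)
      ... | inj₂ (inj₂ tz) = inj₂ (full uz tz)
      pick : Dec (a₁ ≡ s) → Dec (a₁ ≡ t) → Dec (a₂ ≡ s) → Dec (a₂ ≡ t) → Heavy s u ⊎ Heavy t u
      pick (no ≢s) (no ≢t) _ _ = with-third c~₁ ≢s ≢t
      pick _ _ (no ≢s) (no ≢t) = with-third c~₂ ≢s ≢t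
      pick (yes refl) _ (yes a₂≡s) _ = ⊥-elim (a₁≢a₂ (sym a₂≡s))
      pick _ (yes refl) _ (yes a₂≡t) = ⊥-elim (a₁≢a₂ (sym a₂≡t))
      pick (yes refl) _ _ (yes refl) = with-third c~₃ (≢-sym a₁≢a₃) (≢-sym a₂≢a₃)
      pick _ (yes refl) (yes refl) _ = with-third c~₃ (≢-sym a₂≢a₃) (≢-sym a₁≢a₃)

    -- A big edge uv makes G balanced bipartite with sides N(u) and N(v), and
    -- Heavy s v says that s ∈ N(v) is adjacent to all of N(u).
    module BigEdge {u v} (uv : u ~ v) (big-v : Big v) (fork-v : Fork v)
                   (dominate : ∀ w → w ~ u ⊎ w ~ v) where

      -- If `r` is a neighbour of `v`, then `v` is adjacent to all three. If `r` is a neighbour of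
      -- `u`, the dominating edge sv makes `r` adjacent to `s`, or to `v`, which closes a triangle.
      full-not-scattered : ∀ {s t r} → v ~ s → v ~ t → Heavy s v → ¬ Scattered s t r
      full-not-scattered {r = r} vs vt s-full sc with dominate r | heavy-edge-dominates (~-sym vs) s-full r
      ... | inj₂ rv | _       = scattered-no-center sc vs vt (~-sym rv)
      ... | inj₁ ru | inj₁ rs = Scattered.¬sr sc (inj₁ (~-sym rs))
      ... | inj₁ ru | inj₂ rv = tf (triangle uv (~-sym ru) (~-sym rv))

      same-side-not-scattered : ∀ {s t r} → v ~ s → v ~ t → ¬ Scattered s t r
      same-side-not-scattered vs vt sc with full-or-full big-v fork-v vs vt (Scattered.s≢t sc)
      ... | inj₁ s-full = full-not-scattered vs vt s-full sc
      ... | inj₂ t-full = full-not-scattered vt vs t-full (scattered-swap sc)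

    -- Two of the three vertices lie on the same side of the bipartition given by the edge uv.
    big-edge-not-scattered : ∀ {u v} → u ~ v → Big u → Big v → Fork u → Fork v →
      ∀ {s t r} → ¬ Scattered s t r
    big-edge-not-scattered {u} {v} uv big-u big-v fork-u fork-v {s} {t} {r} sc =
      pigeonhole (dominate s) (dominate t) (dominate r)
      where
      dominate = heavy-edge-dominates uv (big⇒heavy {u} {v} big-u big-v)
      open BigEdge uv big-v fork-v dominate using ()
        renaming (same-side-not-scattered to side-v)
      open BigEdge (~-sym uv) big-u fork-u (λ w → [ inj₂ , inj₁ ]′ (dominate w)) using ()
        renaming (same-side-not-scattered to side-u)
      pigeonhole : s ~ u ⊎ s ~ v → t ~ u ⊎ t ~ v → r ~ u ⊎ r ~ v → ⊥
      pigeonhole (inj₁ su) (inj₁ tu) _ = side-u (~-sym su) (~-sym tu) sc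
      pigeonhole (inj₂ sv) (inj₂ tv) _ = side-v (~-sym sv) (~-sym tv) sc
      pigeonhole _ (inj₁ tu) (inj₁ ru) = side-u (~-sym tu) (~-sym ru) (scattered-rotate sc)
      pigeonhole _ (inj₂ tv) (inj₂ rv) = side-v (~-sym tv) (~-sym rv) (scattered-rotate sc)
      pigeonhole (inj₁ su) _ (inj₁ ru) = side-u (~-sym ru) (~-sym su) (scattered-rotate (scattered-rotate sc))
      pigeonhole (inj₂ sv) _ (inj₂ rv) = side-v (~-sym rv) (~-sym sv) (scattered-rotate (scattered-rotate sc))

    -- The claw at the fork has a heavy pair, hence a leaf `u` that is big and, by `two-forks`, has
    -- a fork. A big neighbour `y` of `u` makes uy dominating; the other leaves `v` and `w` miss
    -- `u`, so they are adjacent to `y`. Thus `y` has a fork too and `big-edge-not-scattered`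
    -- applies to uy.
    sparse : Sparse
    sparse {s = s} {t} {r} fork sc = from-claw (claw c~₁ c~₂ c~₃ a₁≢a₂ a₁≢a₃ a₂≢a₃)
      where
      open Fork fork

      at-big : ∀ {c u v w} → c ~ u → c ~ v → c ~ w → u ≢ v → u ≢ w → v ≢ w → Big u → Fork u → ⊥
      at-big {c} {u} {v} {w} cu cv cw u≢v u≢w v≢w big-u fork-u with fork⇒big-nbr fork-u
      ... | y , uy , big-y = big-edge-not-scattered uy big-u big-y fork-u fork-y sc
        where
        far : ∀ {x} → c ~ x → y ~ x
        far {x} cx with heavy-edge-dominates uy (big⇒heavy {u} {y} big-u big-y) x
        ... | inj₁ xu = ⊥-elim (~-≁-⊥ xu (siblings-≁ cx cu))
        ... | inj₂ xy = ~-sym xy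
        fork-y : Fork y
        fork-y = record { c~₁ = ~-sym uy ; c~₂ = far cv ; c~₃ = far cw
                        ; a₁≢a₂ = u≢v ; a₁≢a₃ = u≢w ; a₂≢a₃ = v≢w }

      at-heavy : ∀ {c u v w} → c ~ u → c ~ v → c ~ w → u ≢ v → u ≢ w → v ≢ w → ¬ Heavy u v
      at-heavy {c} {u} {v} cu cv cw u≢v u≢w v≢w heavy
        with two-forks cu cv cw u≢v u≢w v≢w heavy | heavy⇒big {u} {v} heavy
      ... | fork-u , _ | inj₁ big-u = at-big cu cv cw u≢v u≢w v≢w big-u fork-u
      ... | _ , fork-v | inj₂ big-v = at-big cv cu cw (≢-sym u≢v) v≢w u≢w big-v fork-v

      from-claw : Heavy a₁ a₂ ⊎ Heavy a₁ a₃ ⊎ Heavy a₂ a₃ → ⊥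
      from-claw (inj₁ h)        = at-heavy c~₁ c~₂ c~₃ a₁≢a₂ a₁≢a₃ a₂≢a₃ h
      from-claw (inj₂ (inj₁ h)) = at-heavy c~₁ c~₃ c~₂ a₁≢a₃ a₁≢a₂ (≢-sym a₂≢a₃) h
      from-claw (inj₂ (inj₂ h)) = at-heavy c~₂ c~₃ c~₁ a₂≢a₃ (≢-sym a₁≢a₂) (≢-sym a₁≢a₃) h

  -- Sufficiency for Z₁

  module Z1Free (free : Free Z1 G) where

    -- Otherwise `y` is pendant at the triangle, which gives an induced Z₁.
    triangle-nbr : ∀ {p q t y} → Triangle t p q → y ~ t → y ~ p ⊎ y ~ q
    triangle-nbr {p} {q} {t} {y} (triangle tp tq pq) yt with y ~? p | y ~? q
    ... | yes yp | _      = inj₁ yp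
    ... | _      | yes yq = inj₂ yq
    ... | no ¬yp | no ¬yq = ⊥-elim (free f (induced-copy Z1 G f (upper-triangle
      {P = λ i j → f i ≢ f j × adj G (f i) (f j) ≡ adj Z1 i j}
      (~⇒≢ tp , tp) (~⇒≢ tq , tq) (~⇒≢ (~-sym yt) , ~-sym yt) (~⇒≢ pq , pq)
      ((λ { refl → ¬yq pq }) , ≁-sym (¬~⇒≁ ¬yp))
      ((λ { refl → ¬yp (~-sym pq) }) , ≁-sym (¬~⇒≁ ¬yq)))))
      where f = quad t p q y

    data TwoOf (y p q t : V) : Set where
      via-pq : y ~ p → y ~ q → TwoOf y p q t
      via-pt : y ~ p → y ~ t → TwoOf y p q t
      via-qt : y ~ q → y ~ t → TwoOf y p q t

    module _ {p q t} (T : Triangle p q t) where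

      open Triangle T renaming (pq to p~q; pt to p~t; qt to q~t)

      one⇒two : ∀ {y} → y ~ p ⊎ y ~ q ⊎ y ~ t → TwoOf y p q t
      one⇒two (inj₁ yp) = [ via-pq yp , via-pt yp ]′ (triangle-nbr T yp)
      one⇒two (inj₂ (inj₁ yq)) =
        [ (λ yp → via-pq yp yq) , via-qt yq ]′ (triangle-nbr (triangle (~-sym p~q) q~t p~t) yq)
      one⇒two (inj₂ (inj₂ yt)) =
        [ (λ yp → via-pt yp yt) , (λ yq → via-qt yq yt) ]′
          (triangle-nbr (triangle (~-sym p~t) (~-sym q~t) p~q) yt)

      -- Induction along the walk: the next vertex `u` forms a triangle with two of `p`, `q`, `t`,
      -- so its neighbour `y` is adjacent to one of those two, and then by `one⇒two` to a second
      -- vertex of the original triangle.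
      two-of-triangle : ∀ {y} → Reach G y p → TwoOf y p q t
      two-of-triangle here = via-qt p~q p~t
      two-of-triangle (step yu u⇝p) with two-of-triangle u⇝p
      ... | via-pq up uq = one⇒two ([ inj₁ , inj₂ ∘ inj₁ ]′ (triangle-nbr (triangle up uq p~q) yu))
      ... | via-pt up ut = one⇒two ([ inj₁ , inj₂ ∘ inj₂ ]′ (triangle-nbr (triangle up ut p~t) yu))
      ... | via-qt uq ut = one⇒two (inj₂ ([ inj₁ , inj₂ ]′ (triangle-nbr (triangle uq ut q~t) yu)))

    triangle-through : ∀ {p q t} → Triangle p q t → ∀ s → ∃₂ λ a b → Triangle s a b
    triangle-through {p} T s with two-of-triangle T (conn s p)
    ... | via-pq sp sq = _ , _ , triangle sp sq (Triangle.pq T)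
    ... | via-pt sp st = _ , _ , triangle sp st (Triangle.pt T)
    ... | via-qt sq st = _ , _ , triangle sq st (Triangle.qt T)

    non-nbr-adjacent : ∀ {s a b x} → Triangle s a b → x ≁ s → x ~ a
    non-nbr-adjacent {s} {x = x} T x≁s with two-of-triangle T (conn x s)
    ... | via-pq xs _ = ⊥-elim (~-≁-⊥ xs x≁s)
    ... | via-pt xs _ = ⊥-elim (~-≁-⊥ xs x≁s)
    ... | via-qt xa _ = xa

    -- By `two-of-triangle`, `s` lies in a triangle s a b. Since `t` and `r` miss `s`, both are
    -- adjacent to `a`, so `a` is adjacent to all three.
    triangle⇒not-scattered : ∀ {p q t} → Triangle p q t → ∀ {s t r} → ¬ Scattered s t r
    triangle⇒not-scattered T {s} sc with triangle-through T s
    ... | a , b , sab = scattered-no-center sc (~-sym (Triangle.pq sab))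
      (~-sym (non-nbr-adjacent sab (≁-sym (¬Link⇒≁ (Scattered.¬st sc)))))
      (~-sym (non-nbr-adjacent sab (≁-sym (¬Link⇒≁ (Scattered.¬sr sc)))))

    triangle? : Dec (∃ λ p → ∃ λ q → ∃ λ t → p ~ q × p ~ t × q ~ t)
    triangle? = any? λ p → any? λ q → any? λ t → (p ~? q) ×-dec (p ~? t) ×-dec (q ~? t)

    traceable : Traceable G
    traceable with triangle?
    ... | yes (_ , _ , _ , pq , pt , qt) =
      sparse⇒traceable conn (λ _ → triangle⇒not-scattered (triangle pq pt qt))
    ... | no none = sparse⇒traceable conn
      (TriangleFree.sparse (λ (triangle pq pt qt) → none (_ , _ , _ , pq , pt , qt)))

-- Induced copies, isomorphisms and connectedness

injective⇒surjective : ∀ {k m} (f : Fin k → Fin m) → Injective _≡_ _≡_ f → m ≤ k → ∀ y → ∃ λ x → f x ≡ y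
injective⇒surjective {k} {suc m} f inj m<k y with any? (λ x → f x Fin.≟ y)
... | yes found = found
... | no  none  = ⊥-elim (<⇒≱ m<k (Fin.injective⇒≤ {f = λ x → punchOut (avoid x)}
  (λ {x} {x′} eq → inj (Fin.punchOut-injective (avoid x) (avoid x′) eq))))
  where
  avoid : ∀ x → y ≢ f x
  avoid x y≡fx = none (x , sym y≡fx)

-- Needed because decoding the code of a function returns that function only pointwise.
copy-cong : ∀ {H G f g} → f ≗ g → InducedCopy H G f → InducedCopy H G g
copy-cong {G = G} f≗g (inj , ad) =
  (λ {i} {j} eq → inj (trans (f≗g i) (trans eq (sym (f≗g j))))) ,
  (λ i j → trans (cong₂ (adj G) (sym (f≗g i)) (sym (f≗g j))) (ad i j))

copy-∘ : ∀ {A B C f g} → InducedCopy A B f → InducedCopy B C g → InducedCopy A C (g ∘ f)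
copy-∘ {f = f} (f-inj , f-adj) (g-inj , g-adj) =
  f-inj ∘ g-inj , λ i j → trans (g-adj (f i) (f j)) (f-adj i j)

copy? : ∀ H G f → Dec (InducedCopy H G f)
copy? H G f =
  map′ (λ inj {i} {j} → inj i j) (λ inj i j → inj {i} {j})
    (all? λ i → all? λ j → (f i Fin.≟ f j) →-dec (i Fin.≟ j))
  ×-dec (all? λ i → all? λ j → adj G (f i) (f j) Bool.≟ adj H i j)

-- Maps of vertex sets are coded by the numbers below `n G ^ n H`, so the search is finite.
embeds? : ∀ H G → Dec (∃ λ f → InducedCopy H G f)
embeds? H G = map′ (λ (x , c) → finToFun x , c)
  (λ (f , c) → funToFin f , copy-cong {H} {G} (λ i → sym (Fin.finToFun-funToFin f i)) c)
  (any? {n = n G ^ n H} (λ x → copy? H G (finToFun x)))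

iso⇒copy : ∀ {S H} (iso : Iso S H) → InducedCopy S H (proj₁ iso)
iso⇒copy (f , g , gf , fg , ad) = (λ {i} {j} eq → trans (sym (gf i)) (trans (cong g eq) (gf j))) , ad

free-along : ∀ {S H G f} → InducedCopy S H f → Free S G → Free H G
free-along {S} {H} {G} {f} c free g c′ = free (g ∘ f) (copy-∘ {S} {H} {G} c c′)

-- Both graphs are isomorphic to the subgraph of `N` induced on the common image of `f` and `h`.
iso-from-copies : ∀ {S H N f h} → InducedCopy S N f → InducedCopy H N h →
  (∀ s → ∃ λ x → h x ≡ f s) → (∀ x → ∃ λ s → f s ≡ h x) → Iso S H
iso-from-copies {N = N} {f} {h} (f-inj , f-adj) (h-inj , h-adj) to from =
  proj₁ ∘ to , proj₁ ∘ from ,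
  (λ s → f-inj (trans (proj₂ (from _)) (proj₂ (to s)))) ,
  (λ x → h-inj (trans (proj₂ (to _)) (proj₂ (from x)))) ,
  (λ i j → trans (sym (h-adj _ _))
    (trans (cong₂ (adj N) (proj₂ (to i)) (proj₂ (to j))) (f-adj i j)))

reach-trans : ∀ {G u v w} → Reach G u v → Reach G v w → Reach G u w
reach-trans here        q = q
reach-trans (step uv p) q = step uv (reach-trans p q)

reach-sym : ∀ {G u v} → Reach G u v → Reach G v u
reach-sym here = here
reach-sym {G} (step {u} {v} uv p) = reach-trans (reach-sym p) (step (trans (adj-sym G v u) uv) here)

reach-root⇒connected : ∀ {G} root → (∀ v → Reach G v root) → Connected G
reach-root⇒connected root reach u v = reach-trans (reach u) (reach-sym (reach v))

-- Pendant vertices obstruct traceability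

module _ (G : Graph) where

  open Paths G using (_~_; ~-sym)

  Pendant : Fin (n G) → Set
  Pendant y = ∃ λ x → ∀ v → y ~ v → v ≡ x

  module _ (p : Fin (n G) → Fin (n G)) (inj : Injective _≡_ _≡_ p)
           (walk : ∀ i j → toℕ j ≡ suc (toℕ i) → p i ~ p j) where

    IsEnd : ℕ → Set
    IsEnd k = k ≡ 0 ⊎ suc k ≡ n G

    -- At an inner position the predecessor and the successor would both be the only neighbour,
    -- although `p` is injective.
    pendant-at-end : ∀ i → Pendant (p i) → IsEnd (toℕ i)
    pendant-at-end i (x , only) = ends (toℕ i) refl
      where
      ends : ∀ k → toℕ i ≡ k → IsEnd (toℕ i)
      ends zero    i≡0 = inj₁ i≡0
      ends (suc k) i≡1+k with suc (toℕ i) Data.Nat.≟ n G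
      ... | yes last = inj₂ last
      ... | no ¬last = ⊥-elim (<⇒≢ k<2+k (trans (sym (Fin.toℕ-fromℕ< k<n))
          (trans (cong toℕ before≡after) (Fin.toℕ-fromℕ< i+1<n))))
        where
        i+1<n : suc (toℕ i) < n G
        i+1<n = ≤∧≢⇒< (Fin.toℕ<n i) ¬last
        k<n : k < n G
        k<n = <-trans (≤-reflexive (sym i≡1+k)) (Fin.toℕ<n i)
        k<2+k : k < suc (toℕ i)
        k<2+k = s≤s (≤-trans (n≤1+n k) (≤-reflexive (sym i≡1+k)))
        before≡after : fromℕ< k<n ≡ fromℕ< i+1<n
        before≡after = inj (trans
          (only _ (~-sym (walk _ i (trans i≡1+k (cong suc (sym (Fin.toℕ-fromℕ< k<n)))))))
          (sym (only _ (walk i _ (Fin.toℕ-fromℕ< i+1<n)))))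

  -- Only two positions are ends, so two of the three vertices would share one.
  three-pendants⇒¬traceable : ∀ {y₁ y₂ y₃} → y₁ ≢ y₂ → y₁ ≢ y₃ → y₂ ≢ y₃ →
    Pendant y₁ → Pendant y₂ → Pendant y₃ → ¬ Traceable G
  three-pendants⇒¬traceable ≢₁₂ ≢₁₃ ≢₂₃ pen₁ pen₂ pen₃ (p , inj , walk) =
    [ ≢₁₂ ∘ same , [ ≢₁₃ ∘ same , ≢₂₃ ∘ same ]′ ]′ (collision (at-end pen₁) (at-end pen₂) (at-end pen₃))
    where
    pos : ∀ y → ∃ λ i → p i ≡ y
    pos = injective⇒surjective p inj ≤-refl
    IsEnd′ : Fin (n G) → Set
    IsEnd′ y = IsEnd p inj walk (toℕ (proj₁ (pos y)))
    at-end : ∀ {y} → Pendant y → IsEnd′ y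
    at-end {y} pen = pendant-at-end p inj walk (proj₁ (pos y)) (subst Pendant (sym (proj₂ (pos y))) pen)
    same : ∀ {y z} → toℕ (proj₁ (pos y)) ≡ toℕ (proj₁ (pos z)) → y ≡ z
    same {y} {z} eq = trans (sym (proj₂ (pos y))) (trans (cong p (Fin.toℕ-injective eq)) (proj₂ (pos z)))
    both-last : ∀ {k l} → suc k ≡ n G → suc l ≡ n G → k ≡ l
    both-last e e′ = suc-injective (trans e (sym e′))
    collision : ∀ {k l m} → IsEnd p inj walk k → IsEnd p inj walk l → IsEnd p inj walk m →
      k ≡ l ⊎ k ≡ m ⊎ l ≡ m
    collision (inj₁ k) (inj₁ l) _        = inj₁ (trans k (sym l))
    collision (inj₂ k) (inj₂ l) _        = inj₁ (both-last k l)
    collision (inj₁ k) _        (inj₁ m) = inj₂ (inj₁ (trans k (sym m)))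
    collision (inj₂ k) _        (inj₂ m) = inj₂ (inj₁ (both-last k m))
    collision _        (inj₁ l) (inj₁ m) = inj₂ (inj₂ (trans l (sym m)))
    collision _        (inj₂ l) (inj₂ m) = inj₂ (inj₂ (both-last l m))

-- The two non-traceable graphs

data Kind (m : ℕ) : Set where
  X Y : Fin 3 → Kind m
  K   : Fin m → Kind m

-- A clique K on m vertices and three paths XᵢYᵢ, with every Xᵢ joined to all of
-- K; the Xᵢ are pairwise adjacent if xx holds and pairwise nonadjacent otherwise.
module Tails (m : ℕ) (xx : Bool) where

  kind : Fin (6 + m) → Kind m
  kind 0F = X 0F
  kind 1F = X 1F
  kind 2F = X 2F
  kind 3F = Y 0F
  kind 4F = Y 1F
  kind 5F = Y 2F
  kind (suc (suc (suc (suc (suc (suc j)))))) = K j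

  vertex : Kind m → Fin (6 + m)
  vertex (X i) = i ↑ˡ (3 + m)
  vertex (Y i) = 3 ↑ʳ (i ↑ˡ m)
  vertex (K j) = 6 ↑ʳ j

  kind-vertex : ∀ a → kind (vertex a) ≡ a
  kind-vertex (X 0F) = refl
  kind-vertex (X 1F) = refl
  kind-vertex (X 2F) = refl
  kind-vertex (Y 0F) = refl
  kind-vertex (Y 1F) = refl
  kind-vertex (Y 2F) = refl
  kind-vertex (K j)  = refl

  vertex-kind : ∀ v → vertex (kind v) ≡ v
  vertex-kind 0F = refl
  vertex-kind 1F = refl
  vertex-kind 2F = refl
  vertex-kind 3F = refl
  vertex-kind 4F = refl
  vertex-kind 5F = refl
  vertex-kind (suc (suc (suc (suc (suc (suc j)))))) = refl

  kind-injective : ∀ {u v} → kind u ≡ kind v → u ≡ v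
  kind-injective {u} {v} eq = trans (sym (vertex-kind u)) (trans (cong vertex eq) (vertex-kind v))

  kadj : Kind m → Kind m → Bool
  kadj (X i) (X j) = xx ∧ not (does (i Fin.≟ j))
  kadj (X i) (Y j) = does (i Fin.≟ j)
  kadj (Y i) (X j) = does (j Fin.≟ i)
  kadj (X _) (K _) = true
  kadj (K _) (X _) = true
  kadj (K i) (K j) = not (does (i Fin.≟ j))
  kadj _     _     = false

  does-≟-sym : ∀ {k} (i j : Fin k) → does (i Fin.≟ j) ≡ does (j Fin.≟ i)
  does-≟-sym i j with i Fin.≟ j
  ... | yes refl = sym (dec-true (j Fin.≟ j) refl)
  ... | no  i≢j  = sym (dec-false (j Fin.≟ i) (≢-sym i≢j))

  kadj-sym : ∀ a b → kadj a b ≡ kadj b a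
  kadj-sym (X i) (X j) = cong (λ z → xx ∧ not z) (does-≟-sym i j)
  kadj-sym (X _) (Y _) = refl
  kadj-sym (X _) (K _) = refl
  kadj-sym (Y _) (X _) = refl
  kadj-sym (Y _) (Y _) = refl
  kadj-sym (Y _) (K _) = refl
  kadj-sym (K _) (X _) = refl
  kadj-sym (K _) (Y _) = refl
  kadj-sym (K i) (K j) = cong not (does-≟-sym i j)

  kadj-irrefl : ∀ a → kadj a a ≡ false
  kadj-irrefl (X i) rewrite dec-true (i Fin.≟ i) refl = Bool.∧-zeroʳ xx
  kadj-irrefl (Y _) = refl
  kadj-irrefl (K i) rewrite dec-true (i Fin.≟ i) refl = refl

  T : Graph
  T = record
    { n = 6 + m
    ; adj = λ u v → kadj (kind u) (kind v)
    ; adj-sym = λ u v → kadj-sym (kind u) (kind v)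
    ; adj-irrefl = λ v → kadj-irrefl (kind v)
    }

  -- The true entries of `kadj` as a family, so that matching leaves only the adjacent cases.
  data Nbr : Kind m → Kind m → Set where
    XX : ∀ {i j} → xx ≡ true → i ≢ j → Nbr (X i) (X j)
    XY : ∀ {i} → Nbr (X i) (Y i)
    YX : ∀ {i} → Nbr (Y i) (X i)
    XK : ∀ {i j} → Nbr (X i) (K j)
    KX : ∀ {i j} → Nbr (K i) (X j)
    KK : ∀ {i j} → i ≢ j → Nbr (K i) (K j)

  nbr : ∀ a b → kadj a b ≡ true → Nbr a b
  nbr (X i) (X j) eq with i Fin.≟ j
  ... | no i≢j = XX (trans (sym (Bool.∧-identityʳ xx)) eq) i≢j
  ... | yes _ with () ← trans (sym (Bool.∧-zeroʳ xx)) eq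
  nbr (X i) (Y j) eq with i Fin.≟ j
  ... | yes refl = XY
  nbr (X i) (K j) _  = XK
  nbr (Y i) (X j) eq with j Fin.≟ i
  ... | yes refl = YX
  nbr (K i) (X j) _  = KX
  nbr (K i) (K j) eq with i Fin.≟ j
  ... | no i≢j = KK i≢j

  Independent : Kind m → Kind m → Set
  Independent a b = a ≢ b × kadj a b ≡ false

  ¬independent-KK : ∀ {i j} → ¬ Independent (K i) (K j)
  ¬independent-KK {i} {j} (≢ , na) with i Fin.≟ j
  ... | yes refl = ≢ refl

  independent-XX : ∀ {i j} → Independent (X i) (X j) → xx ≡ false
  independent-XX {i} {j} (≢ , na) with i Fin.≟ j
  ... | yes refl = ⊥-elim (≢ refl)
  ... | no _     = trans (sym (Bool.∧-identityʳ xx)) na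

  XX-independent-⊥ : ∀ {i j} → xx ≡ true → ¬ Independent (X i) (X j)
  XX-independent-⊥ on ind with () ← trans (sym on) (independent-XX ind)

  -- A Yᵢ has one neighbour. The neighbourhood of an Xᵢ is covered by two cliques, namely Yᵢ and the
  -- rest, so it has no three independent vertices. In the neighbourhood of a vertex of K, every
  -- vertex of K is adjacent to all others, so independent leaves are Xᵢ and these are pairwise
  -- nonadjacent.
  claw-leaves : ∀ {c a₁ a₂ a₃} → Nbr c a₁ → Nbr c a₂ → Nbr c a₃ →
    Independent a₁ a₂ → Independent a₁ a₃ → Independent a₂ a₃ →
    xx ≡ false × (∃ λ i → a₁ ≡ X i) × (∃ λ i → a₂ ≡ X i)
  claw-leaves YX YX _ (≢ , _) _ _ = ⊥-elim (≢ refl)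
  claw-leaves KX KX _ ind _ _ = independent-XX ind , (_ , refl) , (_ , refl)
  claw-leaves KX (KK _) _ (_ , ()) _ _
  claw-leaves (KK _) KX _ (_ , ()) _ _
  claw-leaves (KK _) (KK _) _ ind _ _ = ⊥-elim (¬independent-KK ind)
  claw-leaves (XX on _) (XX _ _) _ ind _ _ = ⊥-elim (XX-independent-⊥ on ind)
  claw-leaves (XX on _) _ (XX _ _) _ ind _ = ⊥-elim (XX-independent-⊥ on ind)
  claw-leaves _ (XX on _) (XX _ _) _ _ ind = ⊥-elim (XX-independent-⊥ on ind)
  claw-leaves XY XY _ (≢ , _) _ _ = ⊥-elim (≢ refl)
  claw-leaves XY _ XY _ (≢ , _) _ = ⊥-elim (≢ refl)
  claw-leaves _ XY XY _ _ (≢ , _) = ⊥-elim (≢ refl)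
  claw-leaves XK XK _ ind _ _ = ⊥-elim (¬independent-KK ind)
  claw-leaves XK _ XK _ ind _ = ⊥-elim (¬independent-KK ind)
  claw-leaves _ XK XK _ _ ind = ⊥-elim (¬independent-KK ind)
  claw-leaves XK (XX _ _) _ (_ , ()) _ _
  claw-leaves XK _ (XX _ _) _ (_ , ()) _
  claw-leaves (XX _ _) XK _ (_ , ()) _ _
  claw-leaves (XX _ _) _ XK _ (_ , ()) _
  claw-leaves _ XK (XX _ _) _ _ (_ , ())
  claw-leaves _ (XX _ _) XK _ _ (_ , ())

  claw-copy-leaves : ∀ f → InducedCopy Claw T f →
    xx ≡ false × (∃ λ i → kind (f 1F) ≡ X i) × (∃ λ i → kind (f 2F) ≡ X i)
  claw-copy-leaves f (inj , ad) =
    claw-leaves (nbr (kind (f 0F)) _ (ad 0F 1F)) (nbr _ _ (ad 0F 2F)) (nbr _ _ (ad 0F 3F))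
      (ind (λ ()) (ad 1F 2F)) (ind (λ ()) (ad 1F 3F)) (ind (λ ()) (ad 2F 3F))
    where
    ind : ∀ {i j} → i ≢ j → kadj (kind (f i)) (kind (f j)) ≡ false → Independent (kind (f i)) (kind (f j))
    ind i≢j na = i≢j ∘ inj ∘ kind-injective , na

  -- A triangle has at least two vertices in K, so `a` or `b` lies in K. The vertex attached there
  -- is in K or an Xᵢ, hence equals or is adjacent to another vertex of the triangle in K. Either
  -- way it has a forbidden adjacency.
  no-bull : xx ≡ false → ∀ {a b c d e} → Nbr a b → Nbr a c → Nbr b c → Nbr a d → Nbr b e →
    kadj d b ≡ false → kadj d c ≡ false → kadj e a ≡ false → kadj e c ≡ false → ⊥
  no-bull off (XX on _) _ _ _ _ _ _ _ _ with () ← trans (sym on) off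
  no-bull off XY (XX on _) _ _ _ _ _ _ _ with () ← trans (sym on) off
  no-bull off YX YX (XX on _) _ _ _ _ _ _ with () ← trans (sym on) off
  no-bull off XK XK (KK _) _ KX _ _ _ ()
  no-bull off XK XK (KK _) _ (KK _) _ _ () _
  no-bull off XK (XX on _) _ _ _ _ _ _ _ with () ← trans (sym on) off
  no-bull off KX _ (XX on _) _ _ _ _ _ _ with () ← trans (sym on) off
  no-bull off KX (KK _) XK KX _ _ () _ _
  no-bull off KX (KK _) XK (KK _) _ () _ _ _
  no-bull off (KK _) _ _ KX _ () _ _ _
  no-bull off (KK {j = j} _) _ b~c (KK {j = l} _) _ d≁b d≁c _ _ with l Fin.≟ j
  ... | yes refl = clash b~c d≁c
    where
    clash : ∀ {c} → Nbr (K l) c → kadj (K l) c ≡ false → ⊥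
    clash (KK {j = q} l≢q) eq with l Fin.≟ q
    ... | yes l≡q = l≢q l≡q

  not-traceable : ¬ Traceable T
  not-traceable = three-pendants⇒¬traceable T {3F} {4F} {5F} (λ ()) (λ ()) (λ ())
    (pendant 3F refl) (pendant 4F refl) (pendant 5F refl)
    where
    pendant : ∀ v {i} → kind v ≡ Y i → Pendant T v
    pendant v {i} eq = vertex (X i) , only
      where
      unique : ∀ {a} → Nbr (Y i) a → a ≡ X i
      unique YX = refl
      only : ∀ w → kadj (kind v) (kind w) ≡ true → w ≡ vertex (X i)
      only w v~w rewrite eq = kind-injective (trans (unique (nbr _ _ v~w)) (sym (kind-vertex (X i))))

  kstep : ∀ {w} a b → kadj a b ≡ true → Reach T (vertex b) w → Reach T (vertex a) w
  kstep a b ab = step (trans (cong₂ kadj (kind-vertex a) (kind-vertex b)) ab)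

  X-reach⇒connected : (∀ i → Reach T (vertex (X i)) 0F) → Connected T
  X-reach⇒connected reach = reach-root⇒connected 0F
    (λ v → subst (λ u → Reach T u 0F) (vertex-kind v) (from (kind v)))
    where
    from : ∀ a → Reach T (vertex a) 0F
    from (X i) = reach i
    from (Y i) = kstep (Y i) (X i) (dec-true (i Fin.≟ i) refl) (reach i)
    from (K j) = kstep (K j) (X 0F) refl here

module Net where

  open Tails 0 true public

  T-connected : Connected T
  T-connected = X-reach⇒connected λ
    { 0F → here ; 1F → step refl here ; 2F → step refl here }

  claw-heavy : ∀ r → ClawHeavy r T
  claw-heavy r f c with () ← proj₁ (claw-copy-leaves f c)

count-const-true : ∀ k → count k (const true) ≡ k
count-const-true zero    = refl
count-const-true (suc k) = cong suc (count-const-true k)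

module Hub (r : ℕ) where

  -- An Xᵢ has degree m + 1 in a graph on 6 + m vertices, and `4 + r` is the least m with 2(m + 1) ≥
  -- 6 + m + r.
  open Tails (4 + r) false public

  T-connected : Connected T
  T-connected = X-reach⇒connected (λ i → kstep (X i) (K 0F) refl (kstep (K 0F) (X 0F) refl here))

  deg-X : ∀ {v i} → kind v ≡ X i → deg T v ≡ 5 + r
  deg-X {v} {i} eq = trans (cong (λ a → count (10 + r) (λ u → kadj a (kind u))) eq) (deg-kind i)
    where
    deg-kind : ∀ i → count (10 + r) (λ u → kadj (X i) (kind u)) ≡ 5 + r
    deg-kind 0F = cong (5 +_) (count-const-true r)
    deg-kind 1F = cong (5 +_) (count-const-true r)
    deg-kind 2F = cong (5 +_) (count-const-true r)

  claw-heavy : ClawHeavy r T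
  claw-heavy f c with claw-copy-leaves f c
  ... | _ , (i , x₁) , (j , x₂) = 1F , 2F , (λ ()) , proj₂ c 1F 2F ,
    ≤-reflexive (trans (double r) (sym (cong₂ _+_ (deg-X x₁) (deg-X x₂))))
    where
    double : ∀ r → 10 + r + r ≡ 5 + r + (5 + r)
    double = solve-∀

-- Necessity: the common induced subgraphs

-- `G` cannot be `S`-free; deciding the embedding turns this negation into a copy.
forbidden⇒embeds : ∀ {r S} G → ForbiddenTraceable r S → Connected G → ClawHeavy r G → ¬ Traceable G →
  ∃ λ f → InducedCopy S G f
forbidden⇒embeds {S = S} G forbidden conn heavy ¬traceable = decidable-stable (embeds? S G)
  (λ none → ¬traceable (forbidden G conn heavy (λ f c → none (f , c))))

-- The cyclic symmetry of the three tails of the net.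
next : Fin 3 → Fin 3
next 0F = 1F
next 1F = 2F
next 2F = 0F

one-of-three : ∀ i l → l ≡ i ⊎ l ≡ next i ⊎ l ≡ next (next i)
one-of-three = from-yes (all? λ i → all? λ l →
  (l Fin.≟ i) ⊎-dec (l Fin.≟ next i) ⊎-dec (l Fin.≟ next (next i)))

i≢next : ∀ i → i ≢ next i
i≢next = from-yes (all? λ i → ¬? (i Fin.≟ next i))

i≢next² : ∀ i → i ≢ next (next i)
i≢next² = from-yes (all? λ i → ¬? (i Fin.≟ next (next i)))

∃-other : ∀ {k} → 2 ≤ k → (i : Fin k) → ∃ λ j → i ≢ j
∃-other (s≤s (s≤s _)) zero    = suc zero , λ ()
∃-other (s≤s (s≤s _)) (suc _) = zero , λ ()

module Classify {r : ℕ} (S : Graph) (conn : Connected S) (3≤n : 3 ≤ n S) (¬P3 : ¬ Iso S P3)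
  {f} (f-copy : InducedCopy S Net.T f) {g} (g-copy : InducedCopy S (Hub.T r) g) where

  open Net

  f-injective : ∀ {s t} → f s ≡ f t → s ≡ t
  f-injective = proj₁ f-copy

  record Hit (a : Kind 0) : Set where
    constructor hit
    field
      source : Fin (n S)
      at     : f source ≡ vertex a

  hit? : ∀ a → Dec (Hit a)
  hit? a = map′ (λ (s , eq) → hit s eq) (λ (hit s eq) → s , eq) (any? (λ s → f s Fin.≟ vertex a))

  -- `S` is connected with a second vertex, so the preimage of Yᵢ has a neighbour, whose image can
  -- only be Xᵢ.
  hit-Y⇒hit-X : ∀ {i} → Hit (Y i) → Hit (X i)
  hit-Y⇒hit-X {i} (hit s fs) with ∃-other (≤-trans (s≤s (s≤s z≤n)) 3≤n) s
  ... | t , s≢t with conn s t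
  ...   | here = ⊥-elim (s≢t refl)
  ...   | step {v = v} sv _ = hit v (trans (sym (vertex-kind (f v))) (cong vertex (only-X nbr-fv)))
    where
    nbr-fv : Nbr (Y i) (kind (f v))
    nbr-fv = nbr _ _ (trans (cong (λ a → kadj a (kind (f v))) (sym (kind-vertex (Y i))))
      (trans (cong (λ u → kadj (kind u) (kind (f v))) (sym fs)) (trans (proj₂ f-copy s v) sv)))
    only-X : ∀ {a} → Nbr (Y i) a → a ≡ X i
    only-X YX = refl

  -- The five preimages form a bull in `S`, which `g` would carry into the hub graph.
  bull-⊥ : ∀ {i j k} → i ≢ j → i ≢ k → j ≢ k → Hit (X i) → Hit (X j) → Hit (X k) → Hit (Y i) → Hit (Y j) → ⊥
  bull-⊥ {i} {j} {k} i≢j i≢k j≢k xi xj xk yi yj =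
    Hub.no-bull r refl
      (edge xi xj (off-diagonal i≢j)) (edge xi xk (off-diagonal i≢k)) (edge xj xk (off-diagonal j≢k))
      (edge xi yi (dec-true (i Fin.≟ i) refl)) (edge xj yj (dec-true (j Fin.≟ j) refl))
      (transfer yi xj (dec-false (j Fin.≟ i) (≢-sym i≢j)))
      (transfer yi xk (dec-false (k Fin.≟ i) (≢-sym i≢k)))
      (transfer yj xi (dec-false (i Fin.≟ j) i≢j))
      (transfer yj xk (dec-false (k Fin.≟ j) (≢-sym j≢k)))
    where
    off-diagonal : ∀ {i j : Fin 3} → i ≢ j → not (does (i Fin.≟ j)) ≡ true
    off-diagonal {i} {j} i≢j = cong not (dec-false (i Fin.≟ j) i≢j)
    transfer : ∀ {a b c} (p : Hit a) (q : Hit b) → kadj a b ≡ c →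
      Hub.kadj r (Hub.kind r (g (Hit.source p))) (Hub.kind r (g (Hit.source q))) ≡ c
    transfer {a} {b} (hit s fs) (hit t ft) ab = trans (proj₂ g-copy s t)
      (trans (sym (proj₂ f-copy s t))
      (trans (cong₂ kadj (trans (cong kind fs) (kind-vertex a)) (trans (cong kind ft) (kind-vertex b))) ab))
    edge : ∀ {a b} (p : Hit a) (q : Hit b) → kadj a b ≡ true →
      Hub.Nbr r (Hub.kind r (g (Hit.source p))) (Hub.kind r (g (Hit.source q)))
    edge p q ab = Hub.nbr r _ _ (transfer p q ab)

  cover : ∀ {k} {h : Fin k → Kind 0} → (∀ a → Hit a → ∃ λ x → h x ≡ a) → ∀ s → ∃ λ x → vertex (h x) ≡ f s
  cover covers s with covers (kind (f s)) (hit s (sym (vertex-kind (f s))))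
  ... | x , eq = x , trans (cong vertex eq) (vertex-kind (f s))

  iso-of-hits : ∀ H {h : Fin (n H) → Kind 0} → InducedCopy H T (vertex ∘ h) →
    (∀ a → Hit a → ∃ λ x → h x ≡ a) → (∀ x → Hit (h x)) → Iso S H
  iso-of-hits H {h} c covers hits = iso-from-copies {S} {H} {T} f-copy c (cover covers)
    (λ x → Hit.source (hits x) , Hit.at (hits x))

  -- `S` has at least three vertices, so if all hits lie on this P₃, every vertex of it is hit and
  -- `S` is P₃.
  three-hits-P3-⊥ : ∀ {h : Fin 3 → Kind 0} → InducedCopy P3 T (vertex ∘ h) →
    ¬ (∀ a → Hit a → ∃ λ x → h x ≡ a)
  three-hits-P3-⊥ {h} c covers = ¬P3 (iso-of-hits P3 c covers hits)
    where
    to : Fin (n S) → Fin 3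
    to = proj₁ ∘ cover covers
    to-injective : ∀ {s t} → to s ≡ to t → s ≡ t
    to-injective {s} {t} eq = f-injective (trans (sym (proj₂ (cover covers s)))
      (trans (cong (vertex ∘ h) eq) (proj₂ (cover covers t))))
    hits : ∀ x → Hit (h x)
    hits x with injective⇒surjective to to-injective 3≤n x
    ... | s , refl = hit s (sym (proj₂ (cover covers s)))

  no-Y⇒C3 : (∀ i → Hit (X i)) → (∀ i → ¬ Hit (Y i)) → Iso S C3
  no-Y⇒C3 allX noY = iso-of-hits C3 {X} (from-yes (copy? C3 T (vertex ∘ X)))
    (λ { (X i) _ → i , refl ; (Y i) y → ⊥-elim (noY i y) }) allX

  one-Y⇒Z1 : (∀ i → Hit (X i)) → ∀ {i} → Hit (Y i) →
    ¬ Hit (Y (next i)) → ¬ Hit (Y (next (next i))) → Iso S Z1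
  one-Y⇒Z1 allX {i} yᵢ ¬yⱼ ¬yₖ = iso-of-hits Z1 {h i} (copies i) covers
    λ { 0F → allX _ ; 1F → allX _ ; 2F → allX _ ; 3F → yᵢ }
    where
    h : Fin 3 → Fin 4 → Kind 0
    h i = quad (X i) (X (next i)) (X (next (next i))) (Y i)
    copies : ∀ i → InducedCopy Z1 T (vertex ∘ h i)
    copies = from-yes (all? λ i → copy? Z1 T (vertex ∘ h i))
    covers : ∀ a → Hit a → ∃ λ x → h i x ≡ a
    covers (X l) _ with one-of-three i l
    ... | inj₁ refl        = 0F , refl
    ... | inj₂ (inj₁ refl) = 1F , refl
    ... | inj₂ (inj₂ refl) = 2F , refl
    covers (Y l) y with one-of-three i l
    ... | inj₁ refl        = 3F , refl
    ... | inj₂ (inj₁ refl) = ⊥-elim (¬yⱼ y)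
    ... | inj₂ (inj₂ refl) = ⊥-elim (¬yₖ y)

  -- Without Xₖ there is no Yₖ either; if Yᵢ is missing too, only the path Xᵢ Xⱼ Yⱼ remains.
  missing-Y-⊥ : ∀ {i j k} → i ≢ j → (∀ l → l ≡ k ⊎ l ≡ i ⊎ l ≡ j) → ¬ Hit (X k) → ¬ ¬ Hit (Y i)
  missing-Y-⊥ {i} {j} i≢j one-of ¬xₖ ¬yᵢ = three-hits-P3-⊥ {h i j} (copies i j i≢j) covers
    where
    h : Fin 3 → Fin 3 → Fin 3 → Kind 0
    h i j 0F = X i
    h i j 1F = X j
    h i j 2F = Y j
    copies : ∀ i j → i ≢ j → InducedCopy P3 T (vertex ∘ h i j)
    copies = from-yes (all? λ i → all? λ j → ¬? (i Fin.≟ j) →-dec copy? P3 T (vertex ∘ h i j))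
    covers : ∀ a → Hit a → ∃ λ x → h i j x ≡ a
    covers (X l) x with one-of l
    ... | inj₁ refl        = ⊥-elim (¬xₖ x)
    ... | inj₂ (inj₁ refl) = 0F , refl
    ... | inj₂ (inj₂ refl) = 1F , refl
    covers (Y l) y with one-of l
    ... | inj₁ refl        = ⊥-elim (¬xₖ (hit-Y⇒hit-X y))
    ... | inj₂ (inj₁ refl) = ⊥-elim (¬yᵢ y)
    ... | inj₂ (inj₂ refl) = 2F , refl

  -- Deleting Xₖ and Yₖ from the net leaves the path Yᵢ Xᵢ Xⱼ Yⱼ, and `missing-Y-⊥` shows that both
  -- of its ends are hit.
  missing-X⇒P4 : ∀ {k} → ¬ Hit (X k) → Iso S P4
  missing-X⇒P4 {k} ¬xₖ with hit? (Y (next k)) | hit? (Y (next (next k)))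
  ... | yes yᵢ | yes yⱼ = iso-of-hits P4 {h k} (copies k) covers
      λ { 0F → yᵢ ; 1F → hit-Y⇒hit-X yᵢ ; 2F → hit-Y⇒hit-X yⱼ ; 3F → yⱼ }
    where
    h : Fin 3 → Fin 4 → Kind 0
    h k = quad (Y (next k)) (X (next k)) (X (next (next k))) (Y (next (next k)))
    copies : ∀ k → InducedCopy P4 T (vertex ∘ h k)
    copies = from-yes (all? λ k → copy? P4 T (vertex ∘ h k))
    covers : ∀ a → Hit a → ∃ λ x → h k x ≡ a
    covers (X l) x with one-of-three k l
    ... | inj₁ refl        = ⊥-elim (¬xₖ x)
    ... | inj₂ (inj₁ refl) = 1F , refl
    ... | inj₂ (inj₂ refl) = 2F , refl
    covers (Y l) y with one-of-three k l
    ... | inj₁ refl        = ⊥-elim (¬xₖ (hit-Y⇒hit-X y))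
    ... | inj₂ (inj₁ refl) = 0F , refl
    ... | inj₂ (inj₂ refl) = 3F , refl
  ... | no ¬yᵢ | _ = ⊥-elim (missing-Y-⊥ (i≢next (next k)) (one-of-three k) ¬xₖ ¬yᵢ)
  ... | _ | no ¬yⱼ = ⊥-elim (missing-Y-⊥ (≢-sym (i≢next (next k)))
      (λ l → [ inj₁ , [ inj₂ ∘ inj₂ , inj₂ ∘ inj₁ ]′ ]′ (one-of-three k l)) ¬xₖ ¬yⱼ)

  classify : Iso S C3 ⊎ Iso S Z1 ⊎ Iso S P4
  classify with all? (λ i → hit? (X i))
  ... | no ¬allX with Fin.¬∀⟶∃¬ 3 (λ i → Hit (X i)) (λ i → hit? (X i)) ¬allX
  ...   | _ , ¬xₖ = inj₂ (inj₂ (missing-X⇒P4 ¬xₖ))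
  classify | yes allX with any? (λ i → hit? (Y i))
  ... | no noY = inj₁ (no-Y⇒C3 allX (λ i y → noY (i , y)))
  ... | yes (i , yᵢ) = inj₂ (inj₁ (one-Y⇒Z1 allX yᵢ
      (bull-⊥ (i≢next i) (i≢next² i) (i≢next (next i)) (allX _) (allX _) (allX _) yᵢ)
      (bull-⊥ (i≢next² i) (i≢next i) (≢-sym (i≢next (next i))) (allX _) (allX _) (allX _) yᵢ)))

-- The characterization

-- Reduces the case of C₃ to that of Z₁, since a C₃-free graph is Z₁-free.
C3⊆Z1 : InducedCopy C3 Z1 inject₁
C3⊆Z1 = from-yes (copy? C3 Z1 inject₁)

theorem11 : (r : ℕ) (S : Graph) → Connected S → 3 ≤ n S → ¬ Iso S P3 →
    ForbiddenTraceable r S ⇔ (Iso S C3 ⊎ Iso S Z1 ⊎ Iso S P4)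
theorem11 r S conn 3≤n ¬P3 = mk⇔ necessary sufficient
  where
  necessary : ForbiddenTraceable r S → Iso S C3 ⊎ Iso S Z1 ⊎ Iso S P4
  necessary forbidden = Classify.classify {r} S conn 3≤n ¬P3
    (proj₂ (forbidden⇒embeds {r} {S} Net.T forbidden Net.T-connected (Net.claw-heavy r) Net.not-traceable))
    (proj₂ (forbidden⇒embeds {r} {S} (Hub.T r) forbidden
      (Hub.T-connected r) (Hub.claw-heavy r) (Hub.not-traceable r)))

  sufficient : Iso S C3 ⊎ Iso S Z1 ⊎ Iso S P4 → ForbiddenTraceable r S
  sufficient (inj₁ iso) G connG heavy free =
    HeavyClaws.Z1Free.traceable G connG heavy
      (free-along {C3} {Z1} {G} C3⊆Z1 (free-along {S} {C3} {G} (iso⇒copy {S} {C3} iso) free))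
  sufficient (inj₂ (inj₁ iso)) G connG heavy free =
    HeavyClaws.Z1Free.traceable G connG heavy (free-along {S} {Z1} {G} (iso⇒copy {S} {Z1} iso) free)
  sufficient (inj₂ (inj₂ iso)) G connG heavy free =
    HeavyClaws.P4Free.traceable G connG heavy (free-along {S} {P4} {G} (iso⇒copy {S} {P4} iso) free)
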